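{- Let $R$ be a ring in which $2$ is a unit, and assume $\operatorname{rank}(\mathbf{V})\geq3$. Let $\tau\in\mathbf{M}_{\mathrm{stab}}(R)$, $a\in\mathbf{G}(R)$ and $y\in\mathbf{X}_{\tau,a}(R)$. Then the following are equivalent: (i) $\mathbf{X}_{\tau,a}$ is doubly-tangential at $y$ over $R$; (ii) $a\in\mathbf{H}(R)\mathbf{Z}(R)$.
   Context: Rings are commutative with $1$. Let $\mathbf{V}$ be a free $\mathbb{Z}$-module of finite rank, $\mathbf{V}^*=\mathrm{Hom}(\mathbf{V},\mathbb{Z})$; fix $e\in\mathbf{V}$, $e^*\in\mathbf{V}^*$ with $e^*(e)=1$. For a ring $R$: $\mathbf{V}(R)=\mathbf{V}\otimes R$, $\mathbf{V}^*(R)=\mathrm{Hom}_R(\mathbf{V}(R),R)$, $\mathbf{M}(R)=\mathrm{End}_R(\mathbf{V}(R))$, $\mathbf{G}(R)=\mathrm{Aut}_R(\mathbf{V}(R))$, $\mathbf{Z}(R)=R^\times$ (scalars). Juxtaposition: $\ell v=\ell(v)$, $xv=x(v)$, $\ell x=\ell\circ x$, $v\ell=(u\mapsto\ell(u)v)$. $\mathbf{V}_H(R)=\{v:e^*v=0\}$, $1_H=1-ee^*$, $\mathbf{M}_H(R)=\mathrm{End}_R(\mathbf{V}_H(R))$ (extended by $0$ on $Re$), $\mathbf{H}(R)=\mathrm{Aut}_R(\mathbf{V}_H(R))$ acting trivially on $Re$ (i.e. $\{g\in\mathbf{G}(R):ge=e,\ e^*g=e^*\}$), $\tau_H=1_H\tau1_H$.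 For an $R$-algebra $R'$: $\mathbf{G}_\tau(R')$ = centralizer of $\tau$ in $\mathbf{G}(R')$; $\mathbf{H}_\sigma(R')$ = centralizer of $\sigma\in\mathbf{M}_H(R)$ in $\mathbf{H}(R')$. $v$ (resp. $\ell$) is $\tau$-cyclic if $R[\tau]v=\mathbf{V}(R)$ (resp. $\ell R[\tau]=\mathbf{V}^*(R)$); $\tau$ is stable if $e$ and $e^*$ are $\tau$-cyclic; $\mathbf{M}_{\mathrm{stab}}(R)$ = stable elements. For $\tau$ stable, $a\in\mathbf{G}(R)$: $\mathbf{X}_{\tau,a}(R')=\{y\in\mathbf{H}_{\tau_H}(R'): ay\in\mathbf{H}(R')\mathbf{G}_\tau(R')\}$. Let $R''=R[\varepsilon_1,\varepsilon_2]/(\varepsilon_1^2,\varepsilon_2^2)$ with the map $R''\to R$ sending $\varepsilon_1,\varepsilon_2\mapsto0$. For $y\in\mathbf{X}_{\tau,a}(R)$, $\mathbf{X}_{\tau,a}$ is doubly-tangential at $y$ over $R$ if every $y''\in\mathbf{H}_{\tau_H}(R'')$ mapping to $y$ under $\mathbf{H}_{\tau_H}(R'')\to\mathbf{H}_{\tau_H}(R)$ lies in $\mathbf{X}_{\tau,a}(R'')$. -}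

module Defs where

open import Level using (Level; _⊔_)
open import Algebra.Bundles using (CommutativeRing)
open import Algebra.Bundles.Raw using (RawRing)
open import Data.Nat as ℕ using (ℕ; zero; suc)
open import Data.Integer as ℤ using (ℤ; +_; -[1+_])
open import Data.Fin using (Fin; zero; suc; _≟_)
open import Data.List using (List; []; _∷_)
open import Data.Product using (Σ; ∃; ∃₂; _×_; _,_)
open import Relation.Nullary using (yes; no)

-- Integer vectors: the lattice V = ℤ^n (a free ℤ-module of rank n with a
-- chosen basis) and V* = ℤ^n (dual basis); pairing e*(e).

sumℤ : ∀ {n} → (Fin n → ℤ) → ℤ
sumℤ {zero}  f = + 0
sumℤ {suc n} f = f zero ℤ.+ sumℤ (λ i → f (suc i))

pairℤ : ∀ {n} → (Fin n → ℤ) → (Fin n → ℤ) → ℤ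
pairℤ ℓ v = sumℤ (λ i → ℓ i ℤ.* v i)

-- Linear algebra over a (raw) ring: V(R) = R^n, V*(R) = R^n (row vectors),
-- M(R) = n×n matrices.

module Lin {c ℓ : Level} (R : RawRing c ℓ) where
  open RawRing R

  Vect : ℕ → Set c
  Vect n = Fin n → Carrier

  Mat : ℕ → Set c
  Mat n = Fin n → Fin n → Carrier

  sumR : ∀ {n} → (Fin n → Carrier) → Carrier
  sumR {zero}  f = 0#
  sumR {suc n} f = f zero + sumR (λ i → f (suc i))

  natR : ℕ → Carrier
  natR zero    = 0#
  natR (suc k) = 1# + natR k

  intR : ℤ → Carrier
  intR (+ k)      = natR k
  intR -[1+ k ]   = - natR (suc k)

  two : Carrier
  two = 1# + 1#

  IsUnit : Carrier → Set (c ⊔ ℓ)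
  IsUnit r = ∃ λ s → r * s ≈ 1#

  _≈ᵥ_ : ∀ {n} → Vect n → Vect n → Set ℓ
  v ≈ᵥ w = ∀ i → v i ≈ w i

  _≈ₘ_ : ∀ {n} → Mat n → Mat n → Set ℓ
  x ≈ₘ y = ∀ i j → x i j ≈ y i j

  _⊙_ : ∀ {n} → Mat n → Vect n → Vect n
  (x ⊙ v) i = sumR (λ k → x i k * v k)

  _⊚_ : ∀ {n} → Vect n → Mat n → Vect n
  (l ⊚ x) j = sumR (λ k → l k * x k j)

  _·_ : ∀ {n} → Mat n → Mat n → Mat n
  (x · y) i j = sumR (λ k → x i k * y k j)

  idM : ∀ {n} → Mat n
  idM i j with i ≟ j
  ... | yes _ = 1#
  ... | no  _ = 0#

  scalarM : ∀ {n} → Carrier → Mat n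
  scalarM r i j = r * idM i j

  outer : ∀ {n} → Vect n → Vect n → Mat n
  outer v l i j = v i * l j

  _−ₘ_ : ∀ {n} → Mat n → Mat n → Mat n
  (x −ₘ y) i j = x i j + - y i j

  scaleV : ∀ {n} → Carrier → Vect n → Vect n
  scaleV r v i = r * v i

  addV : ∀ {n} → Vect n → Vect n → Vect n
  addV v w i = v i + w i

  zeroV : ∀ {n} → Vect n
  zeroV i = 0#

  -- p(τ) v  for p = Σ_k cs_k X^k   (Horner)
  polyApp : ∀ {n} → List Carrier → Mat n → Vect n → Vect n
  polyApp []       τ v = zeroV
  polyApp (c ∷ cs) τ v = addV (scaleV c v) (τ ⊙ polyApp cs τ v)

  polyAppRow : ∀ {n} → List Carrier → Vect n → Mat n → Vect n
  polyAppRow []       l τ = zeroV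
  polyAppRow (c ∷ cs) l τ = addV (scaleV c l) (polyAppRow cs l τ ⊚ τ)

  IsCyclic : ∀ {n} → Mat n → Vect n → Set (c ⊔ ℓ)
  IsCyclic τ v = ∀ w → ∃ λ cs → polyApp cs τ v ≈ᵥ w

  IsCyclicRow : ∀ {n} → Mat n → Vect n → Set (c ⊔ ℓ)
  IsCyclicRow τ l = ∀ m → ∃ λ cs → polyAppRow cs l τ ≈ᵥ m

  InG : ∀ {n} → Mat n → Set (c ⊔ ℓ)
  InG g = ∃ λ h → (g · h) ≈ₘ idM × (h · g) ≈ₘ idM

  InGcent : ∀ {n} → Mat n → Mat n → Set (c ⊔ ℓ)
  InGcent τ g = InG g × (g · τ) ≈ₘ (τ · g)

  module WithE {n : ℕ} (e e* : Fin n → ℤ) where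

    eR : Vect n
    eR i = intR (e i)

    e*R : Vect n
    e*R i = intR (e* i)

    1H : Mat n
    1H = idM −ₘ outer eR e*R

    τH : Mat n → Mat n
    τH τ = (1H · τ) · 1H

    IsStable : Mat n → Set (c ⊔ ℓ)
    IsStable τ = IsCyclic τ eR × IsCyclicRow τ e*R

    InH : Mat n → Set (c ⊔ ℓ)
    InH g = InG g × (g ⊙ eR) ≈ᵥ eR × (e*R ⊚ g) ≈ᵥ e*R

    InHcent : Mat n → Mat n → Set (c ⊔ ℓ)
    InHcent σ h = InH h × (h · σ) ≈ₘ (σ · h)

    -- X_{τ,a}(R), with τ_H supplied as σ (so that base change can be
    -- applied to τ_H computed over the base ring)
    InX' : (τ σ a y : Mat n) → Set (c ⊔ ℓ)
    InX' τ σ a y = InHcent σ y × ∃₂ λ h g → InH h × InGcent τ g × (a · y) ≈ₘ (h · g)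

    InX : (τ a y : Mat n) → Set (c ⊔ ℓ)
    InX τ a y = InX' τ (τH τ) a y

    InHZ : Mat n → Set (c ⊔ ℓ)
    InHZ a = ∃₂ λ h r → InH h × IsUnit r × a ≈ₘ (h · scalarM r)

-- Dual numbers in two variables: R'' = R[ε₁,ε₂]/(ε₁², ε₂²).
-- An element is a + b ε₁ + c ε₂ + d ε₁ε₂.

record D2 {c} (A : Set c) : Set c where
  constructor d2
  field
    c0 c1 c2 c12 : A

module Dual2 {c ℓ : Level} (R : RawRing c ℓ) where
  open RawRing R

  R'' : RawRing c ℓ
  R'' = record
    { Carrier = D2 Carrier
    ; _≈_ = λ x y → D2.c0 x ≈ D2.c0 y × D2.c1 x ≈ D2.c1 y
                   × D2.c2 x ≈ D2.c2 y × D2.c12 x ≈ D2.c12 y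
    ; _+_ = λ x y → d2 (D2.c0 x + D2.c0 y) (D2.c1 x + D2.c1 y)
                       (D2.c2 x + D2.c2 y) (D2.c12 x + D2.c12 y)
    ; _*_ = λ x y → d2 (D2.c0 x * D2.c0 y)
                       (D2.c0 x * D2.c1 y + D2.c1 x * D2.c0 y)
                       (D2.c0 x * D2.c2 y + D2.c2 x * D2.c0 y)
                       (((D2.c0 x * D2.c12 y + D2.c1 x * D2.c2 y)
                          + D2.c2 x * D2.c1 y) + D2.c12 x * D2.c0 y)
    ; -_ = λ x → d2 (- D2.c0 x) (- D2.c1 x) (- D2.c2 x) (- D2.c12 x)
    ; 0# = d2 0# 0# 0# 0#
    ; 1# = d2 1# 0# 0# 0#
    }

  incl : Carrier → D2 Carrier
  incl r = d2 r 0# 0# 0#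

  red : D2 Carrier → Carrier
  red = D2.c0

  baseChange : ∀ {n} → (Fin n → Fin n → Carrier) → (Fin n → Fin n → D2 Carrier)
  baseChange x i j = incl (x i j)

  reduceM : ∀ {n} → (Fin n → Fin n → D2 Carrier) → (Fin n → Fin n → Carrier)
  reduceM x i j = red (x i j)

module Tangential {c ℓ : Level} (R : CommutativeRing c ℓ) where
  private
    Rr = CommutativeRing.rawRing R
  open Dual2 Rr public
  module L  = Lin Rr
  module L'' = Lin R''

  DoublyTangential : ∀ {n} (e e* : Fin n → ℤ) (τ a y : L.Mat n) → Set (c ⊔ ℓ)
  DoublyTangential e e* τ a y =
    ∀ (y'' : L''.Mat _) →
      L''.WithE.InHcent e e* (baseChange (L.WithE.τH e e* τ)) y'' →
      L._≈ₘ_ (reduceM y'') y →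
      L''.WithE.InX' e e* (baseChange τ) (baseChange (L.WithE.τH e e* τ)) (baseChange a) y''

module Submission where

-- If a = h r with r a scalar, then a y = (h y) r for every y in H, over any
-- ring.
--
-- Conversely put b = e* a y and c = y⁻¹ a⁻¹ e. Writing a y = h g shows
-- b = e* g and c = g⁻¹ e with g in R[τ]. Deform y along (1 + ε₁ u)(1 + ε₂ v)
-- for u, v powers of τ_H (on V_H). The coefficients of ε₁ and ε₂ give p_u in
-- R[τ] with u c = p_u c and b u = b p_u, and that of ε₁ε₂ gives
-- 2 p_{uv} c = 2 p_u p_v c, so that u ↦ p_u is multiplicative.
--
-- Let λ = e* c and κ = e* τ c. Modulo λ and κ, the maps τ_H and τ have the
-- same powers on c, hence e* = 0 on R[τ] c = V and this quotient of R is
-- trivial. So κ is invertible modulo λ, and there p_{τ_H} is a scalar and the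
-- span of e and c is stable under τ, hence equal to V; as the rank is at
-- least 3, R/λ is trivial too. So λ is invertible. For u = 1_H we have
-- c = p_u c + λ e and p_u p_u c = p_u c, hence p_u = 0, c = λ e and b is a
-- multiple of e*. Therefore λ a fixes e and e*.

open import Defs
open import Level using (Level; _⊔_)
open import Algebra.Bundles using (CommutativeRing)
open import Algebra.Bundles.Raw using (RawRing)
open import Algebra.Definitions using (Congruent₁; Congruent₂)
open import Algebra.Structures using (IsCommutativeRing)
import Algebra.Properties.Ring as RingProperties
import Algebra.Properties.Semiring.Mult as Mult
import Algebra.Properties.Semiring.Sum as SemiringSum
import Algebra.Solver.Ring.NaturalCoefficients.Default as NaturalSolver
open import Data.Fin using (Fin; zero; suc; _≟_)
open import Data.Integer as ℤ using (ℤ; +_; -[1+_])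
import Data.Integer.Properties as ℤ
open import Data.List using ([]; _∷_)
open import Data.Nat as ℕ using (ℕ; zero; suc; _≥_; z≤n; s≤s)
import Data.Nat.Properties as ℕ
open import Data.Product using (∃; ∃₂; _×_; _,_; proj₁; proj₂)
import Data.Sign as Sign
open import Function.Bundles using (_⇔_; mk⇔)
open import Relation.Binary using (Rel; Setoid; IsEquivalence)
import Relation.Binary.Reasoning.Setoid as SetoidReasoning
open import Relation.Binary.PropositionalEquality as ≡ using (_≡_)
open import Relation.Nullary using (yes; no)

-- The factor 2 comes from reading one factorisation over R'' in two ways. Normalise the factor in
-- G_τ(R'') to 1 + ε₁ p + ε₂ q + ε₁ε₂ r. On the row side it enters directly, so b u v = b r, and as
-- b is cyclic this forces r = p_{uv}. On the column side its inverse enters, and expanding the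
-- inverse to second order gives u v c + r c = 2 p_u p_v c, while the first order in the direction u
-- v gives u v c = p_{uv} c. The column relation alone merely determines r; the row is what turns it
-- into a relation among the p's. R is an arbitrary ring, so invertibility of λ is obtained by
-- deriving 1 = 0 modulo λ: such a congruence exhibits 1 as a multiple of λ. The hypotheses of the
-- argument are therefore collected in a form made of equations and explicit polynomials only, which
-- survives every quotient.

module MatrixOperations {c ℓ} (A : RawRing c ℓ) where

  open RawRing A using (Carrier; _*_)
  open Lin A public hiding (IsUnit; _≈ᵥ_; _≈ₘ_; IsCyclic; IsCyclicRow; InG; InGcent; module WithE)

  infix 8 _∙_

  _∙_ : ∀ {n} → Vect n → Vect n → Carrier
  l ∙ v = sumR (λ i → l i * v i)

  module Corner {n} (e e* : Vect n) (τ : Mat n) where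

    1H τH : Mat n
    1H = idM −ₘ outer e e*
    τH = (1H · τ) · 1H

    -- Powers are taken in End(V_H), extended by zero on e, so the zeroth power is the projection
    -- `1H` and not the identity. That direction is the one which finally makes c a multiple of e.
    τH^ : ℕ → Mat n
    τH^ zero    = 1H
    τH^ (suc k) = τH · τH^ k

-- Linear algebra in coordinates

CommutativeRingFor : ∀ {c ℓ ℓ′} (A : RawRing c ℓ) → Rel (RawRing.Carrier A) ℓ′ → Set (c ⊔ ℓ′)
CommutativeRingFor A _~_ = IsCommutativeRing _~_ _+_ _*_ -_ 0# 1#
  where open RawRing A

-- The equality is a parameter separate from the operations: it is
-- instantiated both with that of the ring and with congruence modulo an
-- element, over the same vectors and matrices.
module LinearAlgebra {c ℓ ℓ′} (A : RawRing c ℓ)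
  (_~_ : Rel (RawRing.Carrier A) ℓ′)
  (isCommutativeRing : CommutativeRingFor A _~_) where

  open RawRing A using (Carrier; _+_; _*_; -_; 0#; 1#)

  commutativeRing : CommutativeRing c ℓ′
  commutativeRing = record { isCommutativeRing = isCommutativeRing }

  open CommutativeRing commutativeRing public
    using (_≈_; setoid; refl; sym; trans; reflexive; +-cong; +-congˡ; +-congʳ; *-cong; *-congˡ; *-congʳ;
      +-assoc; +-comm; +-identityˡ; +-identityʳ; *-assoc; *-comm; *-identityˡ; *-identityʳ;
      distribˡ; distribʳ; zeroˡ; zeroʳ; -‿inverseˡ; -‿inverseʳ; -‿cong; ring; commutativeSemiring)
  open CommutativeRing commutativeRing using (semiring)
  open RingProperties ring public using (+-cancelˡ; +-cancelʳ; -‿distribˡ-*; -‿distribʳ-*; -0#≈0#; -‿+-comm; -‿involutive)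
  open MatrixOperations A
  open SemiringSum semiring using (sum; sum-cong-≋; ∑-distrib-+; ∑-comm; *-distribˡ-sum; sum-replicate-zero)

  infix 4 _≈ᵥ_

  _≈ᵥ_ : ∀ {n} → Rel (Vect n) ℓ′
  v ≈ᵥ w = ∀ i → v i ≈ w i

  Vectₛ : ℕ → Setoid c ℓ′
  Vectₛ n = record
    { Carrier = Vect n
    ; _≈_ = _≈ᵥ_
    ; isEquivalence = record
      { refl = λ i → refl ; sym = λ p i → sym (p i) ; trans = λ p q i → trans (p i) (q i) } }

  module ≈-Reasoning = SetoidReasoning setoid
  module ≈ᵥ-Reasoning {n} = SetoidReasoning (Vectₛ n)

  symᵥ : ∀ {n} {v w : Vect n} → v ≈ᵥ w → w ≈ᵥ v
  symᵥ p i = sym (p i)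

  transᵥ : ∀ {n} {u v w : Vect n} → u ≈ᵥ v → v ≈ᵥ w → u ≈ᵥ w
  transᵥ p q i = trans (p i) (q i)

  addV-cong : ∀ {n} {v v′ w w′ : Vect n} → v ≈ᵥ v′ → w ≈ᵥ w′ → addV v w ≈ᵥ addV v′ w′
  addV-cong p q i = +-cong (p i) (q i)

  scaleV-cong : ∀ {n} {r s} {v w : Vect n} → r ≈ s → v ≈ᵥ w → scaleV r v ≈ᵥ scaleV s w
  scaleV-cong p q i = *-cong p (q i)

  sumR≡sum : ∀ {n} (f : Vect n) → sumR f ≡ sum f
  sumR≡sum {zero}  f = ≡.refl
  sumR≡sum {suc n} f = ≡.cong (λ r → f zero + r) (sumR≡sum (λ i → f (suc i)))

  sumR≈sum : ∀ {n} (f : Vect n) → sumR f ≈ sum f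
  sumR≈sum f = reflexive (sumR≡sum f)

  sumR-cong : ∀ {n} {f g : Vect n} → f ≈ᵥ g → sumR f ≈ sumR g
  sumR-cong {f = f} {g} p = trans (sumR≈sum f) (trans (sum-cong-≋ p) (sym (sumR≈sum g)))

  sumR-+ : ∀ {n} (f g : Vect n) → sumR (addV f g) ≈ sumR f + sumR g
  sumR-+ f g = trans (sumR≈sum (addV f g)) (trans (∑-distrib-+ f g)
    (sym (+-cong (sumR≈sum f) (sumR≈sum g))))

  *-distribˡ-sumR : ∀ {n} r (f : Vect n) → r * sumR f ≈ sumR (scaleV r f)
  *-distribˡ-sumR r f = trans (*-congˡ (sumR≈sum f)) (trans (*-distribˡ-sum r f) (sym (sumR≈sum (scaleV r f))))

  *-distribʳ-sumR : ∀ {n} r (f : Vect n) → sumR f * r ≈ sumR (λ i → f i * r)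
  *-distribʳ-sumR r f = trans (*-comm (sumR f) r)
    (trans (*-distribˡ-sumR r f) (sumR-cong (λ i → *-comm r (f i))))

  sumR-zero : ∀ {n} {f : Vect n} → (∀ i → f i ≈ 0#) → sumR f ≈ 0#
  sumR-zero {n} {f} p = trans (sumR≈sum f) (trans (sum-cong-≋ p) (sum-replicate-zero n))

  sumR-comm : ∀ {m n} (f : Fin m → Fin n → Carrier) →
    sumR (λ i → sumR (f i)) ≈ sumR (λ j → sumR (λ i → f i j))
  sumR-comm f = begin
    sumR (λ i → sumR (f i))        ≈⟨ sumR-cong (λ i → sumR≈sum (f i)) ⟩
    sumR (λ i → sum (f i))         ≈⟨ sumR≈sum (λ i → sum (f i)) ⟩
    sum (λ i → sum (f i))          ≈⟨ ∑-comm f ⟩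
    sum (λ j → sum (λ i → f i j))  ≈⟨ sumR≈sum (λ j → sum (λ i → f i j)) ⟨
    sumR (λ j → sum (λ i → f i j)) ≈⟨ sumR-cong (λ j → sumR≈sum (λ i → f i j)) ⟨
    sumR (λ j → sumR (λ i → f i j)) ∎
    where open ≈-Reasoning

  ∙-cong : ∀ {n} {l m v w : Vect n} → l ≈ᵥ m → v ≈ᵥ w → l ∙ v ≈ m ∙ w
  ∙-cong p q = sumR-cong (λ i → *-cong (p i) (q i))

  ∙-congˡ : ∀ {n} (l : Vect n) {v w : Vect n} → v ≈ᵥ w → l ∙ v ≈ l ∙ w
  ∙-congˡ l q = ∙-cong (λ _ → refl) q

  ∙-comm : ∀ {n} (l v : Vect n) → l ∙ v ≈ v ∙ l
  ∙-comm l v = sumR-cong (λ i → *-comm (l i) (v i))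

  ∙-addV : ∀ {n} (l v w : Vect n) → l ∙ addV v w ≈ l ∙ v + l ∙ w
  ∙-addV l v w = trans (sumR-cong (λ i → distribˡ (l i) (v i) (w i)))
    (sumR-+ (λ i → l i * v i) (λ i → l i * w i))

  ∙-scaleV : ∀ {n} (l : Vect n) r (v : Vect n) → l ∙ scaleV r v ≈ r * l ∙ v
  ∙-scaleV l r v = trans (sumR-cong swap) (sym (*-distribˡ-sumR r (λ i → l i * v i)))
    where
    swap : ∀ i → l i * (r * v i) ≈ r * (l i * v i)
    swap i = trans (sym (*-assoc _ _ _)) (trans (*-congʳ (*-comm _ _)) (*-assoc _ _ _))

  ∙-zeroV : ∀ {n} (l : Vect n) → l ∙ zeroV ≈ 0#
  ∙-zeroV l = sumR-zero (λ i → zeroʳ (l i))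

  -- `idM` is defined through decidable equality of indices, so its block structure does not hold by
  -- computation.
  idM-suc : ∀ {n} (i j : Fin n) → idM (suc i) (suc j) ≡ idM i j
  idM-suc i j with i ≟ j
  ... | yes _ = ≡.refl
  ... | no  _ = ≡.refl

  ⊙-identity : ∀ {n} (v : Vect n) → idM ⊙ v ≈ᵥ v
  ⊙-identity v zero = trans (+-cong (*-identityˡ (v zero)) (sumR-zero (λ i → zeroˡ (v (suc i)))))
    (+-identityʳ (v zero))
  ⊙-identity v (suc i) = trans (+-cong (zeroˡ (v zero))
    (sumR-cong (λ k → *-congʳ (reflexive (idM-suc i k)))))
    (trans (+-identityˡ _) (⊙-identity (λ k → v (suc k)) i))

  idM-sym : ∀ {n} (i j : Fin n) → idM i j ≡ idM j i
  idM-sym zero zero = ≡.refl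
  idM-sym zero (suc j) = ≡.refl
  idM-sym (suc i) zero = ≡.refl
  idM-sym (suc i) (suc j) = ≡.trans (idM-suc i j) (≡.trans (idM-sym i j) (≡.sym (idM-suc j i)))

  ∙-idM : ∀ {n} (l : Vect n) i → l ∙ idM i ≈ l i
  ∙-idM l i = trans (∙-comm l (idM i)) (⊙-identity l i)

  ⊚-identity : ∀ {n} (l : Vect n) → l ⊚ idM ≈ᵥ l
  ⊚-identity l j = trans (∙-congˡ l (λ i → reflexive (idM-sym i j))) (∙-idM l j)

  ⊙-congˡ : ∀ {n} (x : Mat n) {v w : Vect n} → v ≈ᵥ w → x ⊙ v ≈ᵥ x ⊙ w
  ⊙-congˡ x q i = ∙-congˡ (x i) q

  ⊙-addV : ∀ {n} (x : Mat n) v w → x ⊙ addV v w ≈ᵥ addV (x ⊙ v) (x ⊙ w)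
  ⊙-addV x v w i = ∙-addV (x i) v w

  ⊙-scaleV : ∀ {n} (x : Mat n) r v → x ⊙ scaleV r v ≈ᵥ scaleV r (x ⊙ v)
  ⊙-scaleV x r v i = ∙-scaleV (x i) r v

  ⊙-zeroV : ∀ {n} (x : Mat n) → x ⊙ zeroV ≈ᵥ zeroV
  ⊙-zeroV x i = ∙-zeroV (x i)

  -- Exchange of the two summations. With l a row of a matrix it is also the associativity law
  -- `·-⊙`.
  ⊚-∙ : ∀ {n} (l : Vect n) (x : Mat n) (v : Vect n) → (l ⊚ x) ∙ v ≈ l ∙ (x ⊙ v)
  ⊚-∙ l x v = begin
    sumR (λ j → sumR (λ k → l k * x k j) * v j)
      ≈⟨ sumR-cong (λ j → *-distribʳ-sumR (v j) (λ k → l k * x k j)) ⟩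
    sumR (λ j → sumR (λ k → l k * x k j * v j))   ≈⟨ sumR-comm (λ j k → l k * x k j * v j) ⟩
    sumR (λ k → sumR (λ j → l k * x k j * v j))
      ≈⟨ sumR-cong (λ k → sumR-cong (λ j → *-assoc (l k) (x k j) (v j))) ⟩
    sumR (λ k → sumR (λ j → l k * (x k j * v j)))
      ≈⟨ sumR-cong (λ k → *-distribˡ-sumR (l k) (λ j → x k j * v j)) ⟨
    sumR (λ k → l k * sumR (λ j → x k j * v j))   ∎
    where open ≈-Reasoning

  ·-⊙ : ∀ {n} (x y : Mat n) (v : Vect n) → (x · y) ⊙ v ≈ᵥ x ⊙ (y ⊙ v)
  ·-⊙ x y v i = ⊚-∙ (x i) y v

  -- The vector `idM j` extracts column j. This allows matrix identities to be proved through the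
  -- action on vectors, which is how all later ones are handled.
  ⊙-injective : ∀ {n} {x y : Mat n} → (∀ v → x ⊙ v ≈ᵥ y ⊙ v) → ∀ i j → x i j ≈ y i j
  ⊙-injective {x = x} {y} p i j = trans (sym (∙-idM (x i) j)) (trans (p (idM j) i) (∙-idM (y i) j))

  ∙-injective : ∀ {n} {l m : Vect n} → (∀ v → l ∙ v ≈ m ∙ v) → l ≈ᵥ m
  ∙-injective {l = l} {m} p i = trans (sym (∙-idM l i)) (trans (p (idM i)) (∙-idM m i))

  ⊙-congʳ : ∀ {n} {x y : Mat n} → (∀ i j → x i j ≈ y i j) → ∀ v → x ⊙ v ≈ᵥ y ⊙ v
  ⊙-congʳ p v i = ∙-cong (p i) (λ _ → refl)

  scalarM-⊙ : ∀ {n} r (w : Vect n) → scalarM r ⊙ w ≈ᵥ scaleV r w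
  scalarM-⊙ r w i = begin
    sumR (λ k → r * idM i k * w k)    ≈⟨ sumR-cong (λ k → *-assoc r (idM i k) (w k)) ⟩
    sumR (λ k → r * (idM i k * w k))  ≈⟨ *-distribˡ-sumR r (λ k → idM i k * w k) ⟨
    r * sumR (λ k → idM i k * w k)    ≈⟨ *-congˡ (⊙-identity w i) ⟩
    r * w i                           ∎
    where open ≈-Reasoning

-- Cyclic vectors and the centralizer of τ

module Cyclicity {c ℓ ℓ′} (A : RawRing c ℓ)
  (_~_ : Rel (RawRing.Carrier A) ℓ′)
  (isCommutativeRing : CommutativeRingFor A _~_)
  {n} (τ : Lin.Mat A n) where

  open RawRing A using (Carrier; _+_; _*_; -_; 0#; 1#)

  open LinearAlgebra A _~_ isCommutativeRing
  open MatrixOperations A hiding (module Corner)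
  open NaturalSolver commutativeSemiring using (solve; _:=_; _:+_; _:*_)

  -- Stands for membership in R[τ]: the two agree as soon as τ has a cyclic vector, and commutation
  -- is what the centralizer conditions provide directly.
  Central : Mat n → Set (c ⊔ ℓ′)
  Central x = ∀ w → x ⊙ (τ ⊙ w) ≈ᵥ τ ⊙ (x ⊙ w)

  Generates : Vect n → Set (c ⊔ ℓ′)
  Generates v = ∀ w → ∃ λ cs → polyApp cs τ v ≈ᵥ w

  GeneratesDual : Vect n → Set (c ⊔ ℓ′)
  GeneratesDual l = ∀ m → ∃ λ cs → polyAppRow cs l τ ≈ᵥ m

  polyApp-cong : ∀ cs {v w} → v ≈ᵥ w → polyApp cs τ v ≈ᵥ polyApp cs τ w
  polyApp-cong []       p i = refl
  polyApp-cong (a ∷ cs) p   = addV-cong (scaleV-cong refl p) (⊙-congˡ τ (polyApp-cong cs p))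

  polyApp-addV : ∀ cs v w → polyApp cs τ (addV v w) ≈ᵥ addV (polyApp cs τ v) (polyApp cs τ w)
  polyApp-addV []       v w i = sym (+-identityʳ _)
  polyApp-addV (a ∷ cs) v w i = trans
    (+-congˡ (trans (⊙-congˡ τ (polyApp-addV cs v w) i) (⊙-addV τ (polyApp cs τ v) (polyApp cs τ w) i)))
    (solve 5 (λ a v w x y → a :* (v :+ w) :+ (x :+ y) := (a :* v :+ x) :+ (a :* w :+ y)) refl
      a (v i) (w i) _ _)

  polyApp-scaleV : ∀ cs r v → polyApp cs τ (scaleV r v) ≈ᵥ scaleV r (polyApp cs τ v)
  polyApp-scaleV []       r v i = sym (zeroʳ r)
  polyApp-scaleV (a ∷ cs) r v i = trans
    (+-congˡ (trans (⊙-congˡ τ (polyApp-scaleV cs r v) i) (⊙-scaleV τ r (polyApp cs τ v) i)))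
    (solve 4 (λ a r v x → a :* (r :* v) :+ r :* x := r :* (a :* v :+ x)) refl a r (v i) _)

  polyApp-zeroV : ∀ cs → polyApp cs τ zeroV ≈ᵥ zeroV
  polyApp-zeroV []       i = refl
  polyApp-zeroV (a ∷ cs) i = trans
    (+-cong (zeroʳ a) (trans (⊙-congˡ τ (polyApp-zeroV cs) i) (⊙-zeroV τ i))) (+-identityʳ 0#)

  polyApp-central : ∀ {x} → Central x → ∀ cs v → x ⊙ polyApp cs τ v ≈ᵥ polyApp cs τ (x ⊙ v)
  polyApp-central {x} x-central []       v = ⊙-zeroV x
  polyApp-central {x} x-central (a ∷ cs) v = begin
    x ⊙ addV (scaleV a v) (τ ⊙ polyApp cs τ v)
      ≈⟨ ⊙-addV x (scaleV a v) (τ ⊙ polyApp cs τ v) ⟩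
    addV (x ⊙ scaleV a v) (x ⊙ (τ ⊙ polyApp cs τ v))
      ≈⟨ addV-cong (⊙-scaleV x a v) (x-central (polyApp cs τ v)) ⟩
    addV (scaleV a (x ⊙ v)) (τ ⊙ (x ⊙ polyApp cs τ v))
      ≈⟨ addV-cong (λ i → refl) (⊙-congˡ τ (polyApp-central x-central cs v)) ⟩
    addV (scaleV a (x ⊙ v)) (τ ⊙ polyApp cs τ (x ⊙ v)) ∎
    where open ≈ᵥ-Reasoning

  polyApp-τ : ∀ cs v → τ ⊙ polyApp cs τ v ≈ᵥ polyApp cs τ (τ ⊙ v)
  polyApp-τ = polyApp-central {τ} (λ w i → refl)

  polyApp-comm : ∀ cs ds v → polyApp cs τ (polyApp ds τ v) ≈ᵥ polyApp ds τ (polyApp cs τ v)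
  polyApp-comm cs [] v = polyApp-zeroV cs
  polyApp-comm cs (d ∷ ds) v = begin
    polyApp cs τ (addV (scaleV d v) (τ ⊙ polyApp ds τ v))
      ≈⟨ polyApp-addV cs (scaleV d v) (τ ⊙ polyApp ds τ v) ⟩
    addV (polyApp cs τ (scaleV d v)) (polyApp cs τ (τ ⊙ polyApp ds τ v))
      ≈⟨ addV-cong (polyApp-scaleV cs d v) (symᵥ (polyApp-τ cs (polyApp ds τ v))) ⟩
    addV (scaleV d (polyApp cs τ v)) (τ ⊙ polyApp cs τ (polyApp ds τ v))
      ≈⟨ addV-cong (λ i → refl) (⊙-congˡ τ (polyApp-comm cs ds v)) ⟩
    addV (scaleV d (polyApp cs τ v)) (τ ⊙ polyApp ds τ (polyApp cs τ v)) ∎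
    where open ≈ᵥ-Reasoning

  -- Writing w as p(τ) v moves the comparison to v, because x and y commute with p(τ).
  central-ext : ∀ {x y v} → Central x → Central y → Generates v → x ⊙ v ≈ᵥ y ⊙ v →
    ∀ w → x ⊙ w ≈ᵥ y ⊙ w
  central-ext {x} {y} {v} x-central y-central v-gen x≈y w with v-gen w
  ... | cs , cs≈w = begin
    x ⊙ w               ≈⟨ ⊙-congˡ x cs≈w ⟨
    x ⊙ polyApp cs τ v  ≈⟨ polyApp-central x-central cs v ⟩
    polyApp cs τ (x ⊙ v) ≈⟨ polyApp-cong cs x≈y ⟩
    polyApp cs τ (y ⊙ v) ≈⟨ polyApp-central y-central cs v ⟨
    y ⊙ polyApp cs τ v  ≈⟨ ⊙-congˡ y cs≈w ⟩
    y ⊙ w               ∎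
    where open ≈ᵥ-Reasoning

  central-· : ∀ {x y} → Central x → Central y → Central (x · y)
  central-· {x} {y} x-central y-central w = begin
    (x · y) ⊙ (τ ⊙ w) ≈⟨ ·-⊙ x y (τ ⊙ w) ⟩
    x ⊙ (y ⊙ (τ ⊙ w)) ≈⟨ ⊙-congˡ x (y-central w) ⟩
    x ⊙ (τ ⊙ (y ⊙ w)) ≈⟨ x-central (y ⊙ w) ⟩
    τ ⊙ (x ⊙ (y ⊙ w)) ≈⟨ ⊙-congˡ τ (·-⊙ x y w) ⟨
    τ ⊙ ((x · y) ⊙ w) ∎
    where open ≈ᵥ-Reasoning

  -- On the cyclic vector v both x and y act as polynomials in τ, and these commute; `central-ext`
  -- carries this to every vector.
  central-comm : ∀ {x y v} → Generates v → Central x → Central y → ∀ w → x ⊙ (y ⊙ w) ≈ᵥ y ⊙ (x ⊙ w)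
  central-comm {x} {y} {v} v-gen x-central y-central w = begin
    x ⊙ (y ⊙ w) ≈⟨ ·-⊙ x y w ⟨
    (x · y) ⊙ w
      ≈⟨ central-ext (central-· x-central y-central) (central-· y-central x-central) v-gen at-v w ⟩
    (y · x) ⊙ w ≈⟨ ·-⊙ y x w ⟩
    y ⊙ (x ⊙ w) ∎
    where
    open ≈ᵥ-Reasoning
    cs = proj₁ (v-gen (x ⊙ v))
    ds = proj₁ (v-gen (y ⊙ v))
    at-v : (x · y) ⊙ v ≈ᵥ (y · x) ⊙ v
    at-v = begin
      (x · y) ⊙ v          ≈⟨ ·-⊙ x y v ⟩
      x ⊙ (y ⊙ v)          ≈⟨ ⊙-congˡ x (proj₂ (v-gen (y ⊙ v))) ⟨
      x ⊙ polyApp ds τ v   ≈⟨ polyApp-central x-central ds v ⟩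
      polyApp ds τ (x ⊙ v) ≈⟨ polyApp-cong ds (proj₂ (v-gen (x ⊙ v))) ⟨
      polyApp ds τ (polyApp cs τ v) ≈⟨ polyApp-comm ds cs v ⟩
      polyApp cs τ (polyApp ds τ v) ≈⟨ polyApp-cong cs (proj₂ (v-gen (y ⊙ v))) ⟩
      polyApp cs τ (y ⊙ v) ≈⟨ polyApp-central y-central cs v ⟨
      y ⊙ polyApp cs τ v   ≈⟨ ⊙-congˡ y (proj₂ (v-gen (x ⊙ v))) ⟩
      y ⊙ (x ⊙ v)          ≈⟨ ·-⊙ y x v ⟨
      (y · x) ⊙ v          ∎

  -- Since f commutes with τ, f R[τ] v = R[τ] f v, so a polynomial that reaches g w from v reaches w
  -- from f v. This makes c = f e cyclic.
  generates-image : ∀ {f g v} → Central f → (∀ w → f ⊙ (g ⊙ w) ≈ᵥ w) → Generates v → Generates (f ⊙ v)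
  generates-image {f} {g} {v} f-central fg v-gen w with v-gen (g ⊙ w)
  ... | cs , cs≈ = cs , (begin
    polyApp cs τ (f ⊙ v) ≈⟨ polyApp-central f-central cs v ⟨
    f ⊙ polyApp cs τ v   ≈⟨ ⊙-congˡ f cs≈ ⟩
    f ⊙ (g ⊙ w)          ≈⟨ fg w ⟩
    w                    ∎)
    where open ≈ᵥ-Reasoning

  -- The row form of Horner's scheme lets τ meet v first, the vector form applies it last; the two
  -- agree because τ commutes with its own polynomials.
  polyAppRow-∙ : ∀ cs l v → polyAppRow cs l τ ∙ v ≈ l ∙ polyApp cs τ v
  polyAppRow-∙ []       l v = trans (sumR-zero (λ i → zeroˡ (v i))) (sym (∙-zeroV l))
  polyAppRow-∙ (a ∷ cs) l v = begin
    addV (scaleV a l) (r ⊚ τ) ∙ v            ≈⟨ ∙-comm _ v ⟩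
    v ∙ addV (scaleV a l) (r ⊚ τ)            ≈⟨ ∙-addV v (scaleV a l) (r ⊚ τ) ⟩
    v ∙ scaleV a l + v ∙ (r ⊚ τ)             ≈⟨ +-cong (∙-scaleV v a l) (∙-comm v (r ⊚ τ)) ⟩
    a * v ∙ l + (r ⊚ τ) ∙ v                  ≈⟨ +-cong (*-congˡ (∙-comm v l)) (⊚-∙ r τ v) ⟩
    a * l ∙ v + r ∙ (τ ⊙ v)
      ≈⟨ +-cong (sym (∙-scaleV l a v)) (polyAppRow-∙ cs l (τ ⊙ v)) ⟩
    l ∙ scaleV a v + l ∙ polyApp cs τ (τ ⊙ v) ≈⟨ +-congˡ (∙-congˡ l (polyApp-τ cs v)) ⟨
    l ∙ scaleV a v + l ∙ (τ ⊙ polyApp cs τ v) ≈⟨ ∙-addV l (scaleV a v) (τ ⊙ polyApp cs τ v) ⟨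
    l ∙ polyApp (a ∷ cs) τ v                 ∎
    where
    open ≈-Reasoning
    r = polyAppRow cs l τ

  -- Every coordinate functional has the form l p(τ), so the values on the p(τ)-translates determine
  -- the coordinates. This turns statements about rows into statements about vectors.
  nondegenerate : ∀ {l v w} → GeneratesDual l →
    (∀ cs → l ∙ polyApp cs τ v ≈ l ∙ polyApp cs τ w) → v ≈ᵥ w
  nondegenerate {l} {v} {w} l-gen eq i with l-gen (idM i)
  ... | cs , cs≈ = begin
    v i                       ≈⟨ ⊙-identity v i ⟨
    idM i ∙ v                 ≈⟨ ∙-cong cs≈ (λ _ → refl) ⟨
    polyAppRow cs l τ ∙ v     ≈⟨ polyAppRow-∙ cs l v ⟩
    l ∙ polyApp cs τ v        ≈⟨ eq cs ⟩
    l ∙ polyApp cs τ w        ≈⟨ polyAppRow-∙ cs l w ⟨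
    polyAppRow cs l τ ∙ w     ≈⟨ ∙-cong cs≈ (λ _ → refl) ⟩
    idM i ∙ w                 ≈⟨ ⊙-identity w i ⟩
    w i                       ∎
    where open ≈-Reasoning

-- The projection to V_H and the powers of τ_H

module CornerProperties {c ℓ ℓ′} (A : RawRing c ℓ)
  (_~_ : Rel (RawRing.Carrier A) ℓ′)
  (isCommutativeRing : CommutativeRingFor A _~_)
  {n} (e e* : Lin.Vect A n) (τ : Lin.Mat A n) where

  open RawRing A using (Carrier; _+_; _*_; -_; 0#; 1#)

  open LinearAlgebra A _~_ isCommutativeRing
  open MatrixOperations A hiding (module Corner)
  open MatrixOperations.Corner A e e* τ
  open NaturalSolver commutativeSemiring using (solve; _:=_; _:+_; _:*_)

  -- The decomposition of V along V_H and R e, written as a sum so that its consequences follow by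
  -- cancellation.
  1H-split : ∀ w → addV (1H ⊙ w) (scaleV (e* ∙ w) e) ≈ᵥ w
  1H-split w i = begin
    sumR f + e* ∙ w * e i          ≈⟨ +-congˡ (*-distribʳ-sumR (e i) (λ k → e* k * w k)) ⟩
    sumR f + sumR g                ≈⟨ sumR-+ f g ⟨
    sumR (addV f g)                ≈⟨ sumR-cong term ⟩
    sumR (λ k → idM i k * w k)     ≈⟨ ⊙-identity w i ⟩
    w i                            ∎
    where
    open ≈-Reasoning
    f g : Vect n
    f k = (idM i k + - (e i * e* k)) * w k
    g k = e* k * w k * e i
    term : ∀ k → f k + g k ≈ idM i k * w k
    term k = begin
      (d + - x) * w k + e* k * w k * e i
        ≈⟨ +-congˡ (solve 3 (λ a b c → a :* b :* c := (c :* a) :* b) refl (e* k) (w k) (e i)) ⟩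
      (d + - x) * w k + x * w k          ≈⟨ distribʳ (w k) (d + - x) x ⟨
      (d + - x + x) * w k
        ≈⟨ *-congʳ (trans (+-assoc d (- x) x) (trans (+-congˡ (-‿inverseˡ x)) (+-identityʳ d))) ⟩
      d * w k                            ∎
      where
      d = idM i k
      x = e i * e* k

  module _ (e*e≈1 : e* ∙ e ≈ 1#) where

    e*-1H : ∀ w → e* ∙ (1H ⊙ w) ≈ 0#
    e*-1H w = +-cancelʳ (e* ∙ w) _ _ (begin
      e* ∙ (1H ⊙ w) + e* ∙ w            ≈⟨ +-congˡ (trans (*-congˡ e*e≈1) (*-identityʳ _)) ⟨
      e* ∙ (1H ⊙ w) + e* ∙ w * e* ∙ e   ≈⟨ +-congˡ (∙-scaleV e* (e* ∙ w) e) ⟨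
      e* ∙ (1H ⊙ w) + e* ∙ scaleV (e* ∙ w) e ≈⟨ ∙-addV e* (1H ⊙ w) (scaleV (e* ∙ w) e) ⟨
      e* ∙ addV (1H ⊙ w) (scaleV (e* ∙ w) e) ≈⟨ ∙-congˡ e* (1H-split w) ⟩
      e* ∙ w                            ≈⟨ +-identityˡ _ ⟨
      0# + e* ∙ w                       ∎)
      where open ≈-Reasoning

    1H-fix : ∀ {w} → e* ∙ w ≈ 0# → 1H ⊙ w ≈ᵥ w
    1H-fix {w} e*w≈0 i = begin
      (1H ⊙ w) i                ≈⟨ +-identityʳ _ ⟨
      (1H ⊙ w) i + 0#           ≈⟨ +-congˡ (trans (*-congʳ e*w≈0) (zeroˡ (e i))) ⟨
      (1H ⊙ w) i + e* ∙ w * e i ≈⟨ 1H-split w i ⟩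
      w i                       ∎
      where open ≈-Reasoning

    1H-e : 1H ⊙ e ≈ᵥ zeroV
    1H-e i = +-cancelʳ (e i) _ _ (begin
      (1H ⊙ e) i + e i           ≈⟨ +-congˡ (trans (*-congʳ e*e≈1) (*-identityˡ (e i))) ⟨
      (1H ⊙ e) i + e* ∙ e * e i  ≈⟨ 1H-split e i ⟩
      e i                        ≈⟨ +-identityˡ (e i) ⟨
      0# + e i                   ∎)
      where open ≈-Reasoning

    τH-⊙ : ∀ w → τH ⊙ w ≈ᵥ 1H ⊙ (τ ⊙ (1H ⊙ w))
    τH-⊙ w = transᵥ (·-⊙ (1H · τ) 1H w) (·-⊙ 1H τ (1H ⊙ w))

    e*-τH^ : ∀ k w → e* ∙ (τH^ k ⊙ w) ≈ 0#
    e*-τH^ zero    w = e*-1H w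
    e*-τH^ (suc k) w = trans
      (∙-congˡ e* (transᵥ (·-⊙ τH (τH^ k) w) (τH-⊙ (τH^ k ⊙ w)))) (e*-1H _)

    τH-fix : ∀ {w} → e* ∙ w ≈ 0# → τH ⊙ w ≈ᵥ 1H ⊙ (τ ⊙ w)
    τH-fix {w} e*w≈0 = transᵥ (τH-⊙ w) (⊙-congˡ 1H (⊙-congˡ τ (1H-fix e*w≈0)))

    τH^-suc : ∀ k w → τH^ (suc k) ⊙ w ≈ᵥ 1H ⊙ (τ ⊙ (τH^ k ⊙ w))
    τH^-suc k w = transᵥ (·-⊙ τH (τH^ k) w) (τH-fix (e*-τH^ k w))

    τH^-e : ∀ k → τH^ k ⊙ e ≈ᵥ zeroV
    τH^-e zero    = 1H-e
    τH^-e (suc k) = transᵥ (·-⊙ τH (τH^ k) e) (transᵥ (⊙-congˡ τH (τH^-e k)) (⊙-zeroV τH))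

    τH^-+ : ∀ j k w → τH^ j ⊙ (τH^ k ⊙ w) ≈ᵥ τH^ (j ℕ.+ k) ⊙ w
    τH^-+ zero    k w = 1H-fix (e*-τH^ k w)
    τH^-+ (suc j) k w = begin
      (τH · τH^ j) ⊙ (τH^ k ⊙ w)   ≈⟨ ·-⊙ τH (τH^ j) (τH^ k ⊙ w) ⟩
      τH ⊙ (τH^ j ⊙ (τH^ k ⊙ w))   ≈⟨ ⊙-congˡ τH (τH^-+ j k w) ⟩
      τH ⊙ (τH^ (j ℕ.+ k) ⊙ w)     ≈⟨ ·-⊙ τH (τH^ (j ℕ.+ k)) w ⟨
      τH^ (suc j ℕ.+ k) ⊙ w        ∎
      where open ≈ᵥ-Reasoning

    τH^-comm : ∀ j k w → τH^ j ⊙ (τH^ k ⊙ w) ≈ᵥ τH^ k ⊙ (τH^ j ⊙ w)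
    τH^-comm j k w = begin
      τH^ j ⊙ (τH^ k ⊙ w)  ≈⟨ τH^-+ j k w ⟩
      τH^ (j ℕ.+ k) ⊙ w    ≡⟨ ≡.cong (λ m → τH^ m ⊙ w) (ℕ.+-comm j k) ⟩
      τH^ (k ℕ.+ j) ⊙ w    ≈⟨ τH^-+ k j w ⟨
      τH^ k ⊙ (τH^ j ⊙ w)  ∎
      where open ≈ᵥ-Reasoning

    τH^1 : ∀ w → τH^ 1 ⊙ w ≈ᵥ τH ⊙ w
    τH^1 w = transᵥ (τH^-suc 0 w) (symᵥ (τH-⊙ w))

    τH^-τH : ∀ k w → τH^ k ⊙ (τH ⊙ w) ≈ᵥ τH ⊙ (τH^ k ⊙ w)
    τH^-τH k w = begin
      τH^ k ⊙ (τH ⊙ w)    ≈⟨ ⊙-congˡ (τH^ k) (τH^1 w) ⟨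
      τH^ k ⊙ (τH^ 1 ⊙ w) ≈⟨ τH^-comm k 1 w ⟩
      τH^ 1 ⊙ (τH^ k ⊙ w) ≈⟨ τH^1 (τH^ k ⊙ w) ⟩
      τH ⊙ (τH^ k ⊙ w)    ∎
      where open ≈ᵥ-Reasoning

-- Consequences of the intertwining relations for b and c

module Rigidity {c ℓ ℓ′} (A : RawRing c ℓ)
  (_~_ : Rel (RawRing.Carrier A) ℓ′)
  (isCommutativeRing : CommutativeRingFor A _~_)
  {n} (e e* : Lin.Vect A n) (τ : Lin.Mat A n) where

  open RawRing A using (Carrier; _+_; _*_; -_; 0#; 1#)

  open LinearAlgebra A _~_ isCommutativeRing
  open MatrixOperations A hiding (module Corner)
  open NaturalSolver commutativeSemiring using (solve; _:=_; _:+_; _:*_; con)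
  open Cyclicity A _~_ isCommutativeRing τ
  open CornerProperties A _~_ isCommutativeRing e e* τ
  open MatrixOperations.Corner A e e* τ

  -- p k is the element of R[τ] through which τH^ k acts on the vector
  -- c = f e and on the covector b = e* g.
  record Intertwined (f g : Mat n) (p : ℕ → Mat n) : Set (c ⊔ ℓ′) where
    field
      e*e≈1      : e* ∙ e ≈ 1#
      e-gen      : Generates e
      e*-gen     : GeneratesDual e*
      f-central  : Central f
      g-central  : Central g
      p-central  : ∀ k → Central (p k)
      fg         : ∀ w → f ⊙ (g ⊙ w) ≈ᵥ w
      gf         : ∀ w → g ⊙ (f ⊙ w) ≈ᵥ w
      τH^-column : ∀ k → τH^ k ⊙ (f ⊙ e) ≈ᵥ p k ⊙ (f ⊙ e)
      τH^-row    : ∀ k w → e* ∙ (g ⊙ (τH^ k ⊙ w)) ≈ e* ∙ (g ⊙ (p k ⊙ w))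
      p-+        : ∀ j k → p j ⊙ (p k ⊙ (f ⊙ e)) ≈ᵥ p (j ℕ.+ k) ⊙ (f ⊙ e)

  module _ {f g : Mat n} {p : ℕ → Mat n} (I : Intertwined f g p) where
    open Intertwined I

    c-gen : Generates (f ⊙ e)
    c-gen = generates-image f-central fg e-gen

    central-comm′ : ∀ {x y} → Central x → Central y → ∀ w → x ⊙ (y ⊙ w) ≈ᵥ y ⊙ (x ⊙ w)
    central-comm′ = central-comm e-gen

    module _ (e*c≈0 : e* ∙ (f ⊙ e) ≈ 0#) (e*τc≈0 : e* ∙ (τ ⊙ (f ⊙ e)) ≈ 0#) where

      private
        -- Both projections in `τH` act trivially here: the inner one because e* c = 0, the outer
        -- one because e* τ c = 0.
        p1-c : p 1 ⊙ (f ⊙ e) ≈ᵥ τ ⊙ (f ⊙ e)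
        p1-c = begin
          p 1 ⊙ (f ⊙ e)                ≈⟨ τH^-column 1 ⟨
          τH^ 1 ⊙ (f ⊙ e)              ≈⟨ τH^-suc e*e≈1 0 (f ⊙ e) ⟩
          1H ⊙ (τ ⊙ (1H ⊙ (f ⊙ e)))    ≈⟨ ⊙-congˡ 1H (⊙-congˡ τ (1H-fix e*e≈1 e*c≈0)) ⟩
          1H ⊙ (τ ⊙ (f ⊙ e))           ≈⟨ 1H-fix e*e≈1 e*τc≈0 ⟩
          τ ⊙ (f ⊙ e)                  ∎
          where open ≈ᵥ-Reasoning

        -- Moving τ past `p k` replaces τ c by `p 1` applied to c, and multiplicativity of p merges
        -- the two factors. Hence τ just shifts the sequence `τH^ k` c.
        τ-τH^ : ∀ k → τ ⊙ (τH^ k ⊙ (f ⊙ e)) ≈ᵥ τH^ (suc k) ⊙ (f ⊙ e)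
        τ-τH^ k = begin
          τ ⊙ (τH^ k ⊙ (f ⊙ e))   ≈⟨ ⊙-congˡ τ (τH^-column k) ⟩
          τ ⊙ (p k ⊙ (f ⊙ e))     ≈⟨ p-central k (f ⊙ e) ⟨
          p k ⊙ (τ ⊙ (f ⊙ e))     ≈⟨ ⊙-congˡ (p k) p1-c ⟨
          p k ⊙ (p 1 ⊙ (f ⊙ e))   ≈⟨ central-comm′ (p-central k) (p-central 1) (f ⊙ e) ⟩
          p 1 ⊙ (p k ⊙ (f ⊙ e))   ≈⟨ p-+ 1 k ⟩
          p (suc k) ⊙ (f ⊙ e)     ≈⟨ τH^-column (suc k) ⟨
          τH^ (suc k) ⊙ (f ⊙ e)   ∎
          where open ≈ᵥ-Reasoning

        -- The exponent k is generalised because the tail of Horner's scheme carries a factor τ,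
        -- which raises k by one; e* kills each `τH^ k` c.
        e*-polyApp : ∀ cs k → e* ∙ polyApp cs τ (τH^ k ⊙ (f ⊙ e)) ≈ 0#
        e*-polyApp []       k = ∙-zeroV e*
        e*-polyApp (a ∷ cs) k = begin
          e* ∙ addV (scaleV a u) (τ ⊙ polyApp cs τ u)
            ≈⟨ ∙-addV e* (scaleV a u) (τ ⊙ polyApp cs τ u) ⟩
          e* ∙ scaleV a u + e* ∙ (τ ⊙ polyApp cs τ u)
            ≈⟨ +-cong (trans (∙-scaleV e* a u) (*-congˡ (e*-τH^ e*e≈1 k (f ⊙ e))))
                 (∙-congˡ e* (transᵥ (polyApp-τ cs u) (polyApp-cong cs (τ-τH^ k)))) ⟩
          a * 0# + e* ∙ polyApp cs τ (τH^ (suc k) ⊙ (f ⊙ e))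
            ≈⟨ +-cong (zeroʳ a) (e*-polyApp cs (suc k)) ⟩
          0# + 0#
            ≈⟨ +-identityʳ 0# ⟩
          0# ∎
          where
          open ≈-Reasoning
          u = τH^ k ⊙ (f ⊙ e)

      -- τH and τ have the same powers on c, so e* vanishes on R[τ] c = V.
      e*c,e*τc≈0⇒trivial : 1# ≈ 0#
      e*c,e*τc≈0⇒trivial with c-gen e
      ... | cs , cs≈e = begin
        1#                             ≈⟨ e*e≈1 ⟨
        e* ∙ e                         ≈⟨ ∙-congˡ e* cs≈e ⟨
        e* ∙ polyApp cs τ (f ⊙ e)           ≈⟨ ∙-congˡ e* (polyApp-cong cs (1H-fix e*e≈1 e*c≈0)) ⟨
        e* ∙ polyApp cs τ (τH^ 0 ⊙ (f ⊙ e)) ≈⟨ e*-polyApp cs 0 ⟩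
        0#                             ∎
        where open ≈-Reasoning

    -- Here V is spanned by c and e, because their span is stable under τ.
    module _ (e*c≈0 : e* ∙ (f ⊙ e) ≈ 0#) where

      private
        κ κ′ μ : Carrier
        κ  = e* ∙ (τ ⊙ (f ⊙ e))
        κ′ = e* ∙ (g ⊙ (τ ⊙ e))
        μ  = e* ∙ (τ ⊙ (p 1 ⊙ (f ⊙ e)))

        1H-c : 1H ⊙ (f ⊙ e) ≈ᵥ (f ⊙ e)
        1H-c = 1H-fix e*e≈1 e*c≈0

        -- As c lies in V_H, it is fixed by `1H` and hence by `p 0`; an endomorphism that commutes
        -- with τ and fixes a cyclic vector is the identity.
        p0-fix : ∀ w → p 0 ⊙ w ≈ᵥ w
        p0-fix w = transᵥ (central-ext (p-central 0) idM-central c-gen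
          (transᵥ (symᵥ (τH^-column 0)) (transᵥ 1H-c (symᵥ (⊙-identity (f ⊙ e))))) w) (⊙-identity w)
          where
          idM-central : Central idM
          idM-central w = transᵥ (⊙-identity (τ ⊙ w)) (⊙-congˡ τ (symᵥ (⊙-identity w)))

        -- The dual of e* c = 0. With b = e* g, the row relation at zero reads b `1H` = b `p 0` = b,
        -- and `1H` kills e.
        e*ge≈0 : e* ∙ (g ⊙ e) ≈ 0#
        e*ge≈0 = begin
          e* ∙ (g ⊙ e)        ≈⟨ ∙-congˡ e* (⊙-congˡ g (p0-fix e)) ⟨
          e* ∙ (g ⊙ (p 0 ⊙ e)) ≈⟨ τH^-row 0 e ⟨
          e* ∙ (g ⊙ (1H ⊙ e)) ≈⟨ ∙-congˡ e* (⊙-congˡ g (1H-e e*e≈1)) ⟩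
          e* ∙ (g ⊙ zeroV)    ≈⟨ ∙-congˡ e* (⊙-zeroV g) ⟩
          e* ∙ zeroV          ≈⟨ ∙-zeroV e* ⟩
          0#                  ∎
          where open ≈-Reasoning

        τc : addV (p 1 ⊙ (f ⊙ e)) (scaleV κ e) ≈ᵥ τ ⊙ (f ⊙ e)
        τc i = trans (+-congʳ (begin
          (p 1 ⊙ (f ⊙ e)) i             ≈⟨ τH^-column 1 i ⟨
          (τH^ 1 ⊙ (f ⊙ e)) i           ≈⟨ τH^-suc e*e≈1 0 (f ⊙ e) i ⟩
          (1H ⊙ (τ ⊙ (1H ⊙ (f ⊙ e)))) i ≈⟨ ⊙-congˡ 1H (⊙-congˡ τ 1H-c) i ⟩
          (1H ⊙ (τ ⊙ (f ⊙ e))) i        ∎)) (1H-split (τ ⊙ (f ⊙ e)) i)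
          where open ≈-Reasoning

        -- The V_H-component is `τH^ 2` c, which multiplicativity of p rewrites as p_1 p_1 c; μ is
        -- the remaining coefficient along e.
        τp1c : addV (p 1 ⊙ (p 1 ⊙ (f ⊙ e))) (scaleV μ e) ≈ᵥ τ ⊙ (p 1 ⊙ (f ⊙ e))
        τp1c i = trans (+-congʳ (begin
          (p 1 ⊙ (p 1 ⊙ (f ⊙ e))) i       ≈⟨ p-+ 1 1 i ⟩
          (p 2 ⊙ (f ⊙ e)) i               ≈⟨ τH^-column 2 i ⟨
          (τH^ 2 ⊙ (f ⊙ e)) i             ≈⟨ τH^-suc e*e≈1 1 (f ⊙ e) i ⟩
          (1H ⊙ (τ ⊙ (τH^ 1 ⊙ (f ⊙ e)))) i ≈⟨ ⊙-congˡ 1H (⊙-congˡ τ (τH^-column 1)) i ⟩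
          (1H ⊙ (τ ⊙ (p 1 ⊙ (f ⊙ e)))) i  ∎)) (1H-split (τ ⊙ (p 1 ⊙ (f ⊙ e))) i)
          where open ≈-Reasoning

        -- Apply `p 1` to `τc` and commute it past τ: comparison with `τp1c` leaves only the terms
        -- along e. Inverting κ will make `p 1` a scalar on e.
        κp1e : scaleV κ (p 1 ⊙ e) ≈ᵥ scaleV μ e
        κp1e i = +-cancelˡ ((p 1 ⊙ (p 1 ⊙ (f ⊙ e))) i) _ _ (begin
          (p 1 ⊙ (p 1 ⊙ (f ⊙ e))) i + κ * (p 1 ⊙ e) i         ≈⟨ +-congˡ (⊙-scaleV (p 1) κ e i) ⟨
          (p 1 ⊙ (p 1 ⊙ (f ⊙ e))) i + (p 1 ⊙ scaleV κ e) i
            ≈⟨ ⊙-addV (p 1) (p 1 ⊙ (f ⊙ e)) (scaleV κ e) i ⟨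
          (p 1 ⊙ addV (p 1 ⊙ (f ⊙ e)) (scaleV κ e)) i         ≈⟨ ⊙-congˡ (p 1) τc i ⟩
          (p 1 ⊙ (τ ⊙ (f ⊙ e))) i                             ≈⟨ p-central 1 (f ⊙ e) i ⟩
          (τ ⊙ (p 1 ⊙ (f ⊙ e))) i                             ≈⟨ τp1c i ⟨
          (p 1 ⊙ (p 1 ⊙ (f ⊙ e))) i + μ * e i                 ∎)
          where open ≈-Reasoning

        -- Dual to `τc`, for the covector b = e* g: since b e = 0, the outer projection of `τH` may
        -- be inserted under b, and the e-component of w accounts for the term with κ′.
        e*gτ : ∀ w → e* ∙ (g ⊙ (τ ⊙ w)) ≈ e* ∙ (g ⊙ (p 1 ⊙ w)) + e* ∙ w * κ′
        e*gτ w = begin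
          b (τ ⊙ w)                                    ≈⟨ b-cong (⊙-congˡ τ (1H-split w)) ⟨
          b (τ ⊙ addV (1H ⊙ w) (scaleV (e* ∙ w) e))
            ≈⟨ b-cong (⊙-addV τ (1H ⊙ w) (scaleV (e* ∙ w) e)) ⟩
          b (addV (τ ⊙ (1H ⊙ w)) (τ ⊙ scaleV (e* ∙ w) e)) ≈⟨ b-addV _ _ ⟩
          b (τ ⊙ (1H ⊙ w)) + b (τ ⊙ scaleV (e* ∙ w) e)
            ≈⟨ +-cong (b-1H (τ ⊙ (1H ⊙ w))) (trans (b-cong (⊙-scaleV τ (e* ∙ w) e)) (b-scaleV (e* ∙ w) (τ ⊙ e))) ⟩
          b (1H ⊙ (τ ⊙ (1H ⊙ w))) + e* ∙ w * κ′        ≈⟨ +-congʳ (b-cong (τH^-suc e*e≈1 0 w)) ⟨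
          b (τH^ 1 ⊙ w) + e* ∙ w * κ′                  ≈⟨ +-congʳ (τH^-row 1 w) ⟩
          b (p 1 ⊙ w) + e* ∙ w * κ′                    ∎
          where
          open ≈-Reasoning
          b : Vect n → Carrier
          b v = e* ∙ (g ⊙ v)
          b-cong : ∀ {v v′} → v ≈ᵥ v′ → b v ≈ b v′
          b-cong q = ∙-congˡ e* (⊙-congˡ g q)
          b-addV : ∀ v v′ → b (addV v v′) ≈ b v + b v′
          b-addV v v′ = trans (∙-congˡ e* (⊙-addV g v v′)) (∙-addV e* (g ⊙ v) (g ⊙ v′))
          b-scaleV : ∀ r v → b (scaleV r v) ≈ r * b v
          b-scaleV r v = trans (∙-congˡ e* (⊙-scaleV g r v)) (∙-scaleV e* r (g ⊙ v))
          b-1H : ∀ v → b v ≈ b (1H ⊙ v)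
          b-1H v = begin
            b v                                      ≈⟨ b-cong (1H-split v) ⟨
            b (addV (1H ⊙ v) (scaleV (e* ∙ v) e))    ≈⟨ b-addV _ _ ⟩
            b (1H ⊙ v) + b (scaleV (e* ∙ v) e)
              ≈⟨ +-congˡ (trans (b-scaleV (e* ∙ v) e) (trans (*-congˡ e*ge≈0) (zeroʳ (e* ∙ v)))) ⟩
            b (1H ⊙ v) + 0#                          ≈⟨ +-identityʳ _ ⟩
            b (1H ⊙ v)                               ∎

        -- Composing `e*gτ` with f gives e* τ = e* p_1 + κ′ e* f. All these operators commute with τ
        -- and e* is cyclic, so τ = p_1 + κ′ f, which is evaluated here at e.
        τe : addV (p 1 ⊙ e) (scaleV κ′ (f ⊙ e)) ≈ᵥ τ ⊙ e
        τe = nondegenerate e*-gen λ cs → sym (begin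
          e* ∙ polyApp cs τ (τ ⊙ e)          ≈⟨ e*-gf cs (τ ⊙ e) ⟩
          e* ∙ (g ⊙ polyApp cs τ (f ⊙ (τ ⊙ e)))
            ≈⟨ ∙-congˡ e* (⊙-congˡ g (transᵥ (polyApp-cong cs (f-central e)) (symᵥ (polyApp-τ cs (f ⊙ e))))) ⟩
          e* ∙ (g ⊙ (τ ⊙ polyApp cs τ (f ⊙ e)))   ≈⟨ e*gτ (polyApp cs τ (f ⊙ e)) ⟩
          e* ∙ (g ⊙ (p 1 ⊙ polyApp cs τ (f ⊙ e))) + e* ∙ polyApp cs τ (f ⊙ e) * κ′
            ≈⟨ +-cong (∙-congˡ e* (⊙-congˡ g (transᵥ (polyApp-central (p-central 1) cs (f ⊙ e)) (polyApp-cong cs (central-comm′ (p-central 1) f-central e))))) (*-comm _ κ′) ⟩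
          e* ∙ (g ⊙ polyApp cs τ (f ⊙ (p 1 ⊙ e))) + κ′ * e* ∙ polyApp cs τ (f ⊙ e)
            ≈⟨ +-cong (e*-gf cs (p 1 ⊙ e)) (∙-scaleV e* κ′ (polyApp cs τ (f ⊙ e))) ⟨
          e* ∙ polyApp cs τ (p 1 ⊙ e) + e* ∙ scaleV κ′ (polyApp cs τ (f ⊙ e))
            ≈⟨ +-congˡ (∙-congˡ e* (polyApp-scaleV cs κ′ (f ⊙ e))) ⟨
          e* ∙ polyApp cs τ (p 1 ⊙ e) + e* ∙ polyApp cs τ (scaleV κ′ (f ⊙ e))
            ≈⟨ ∙-addV e* _ _ ⟨
          e* ∙ addV (polyApp cs τ (p 1 ⊙ e)) (polyApp cs τ (scaleV κ′ (f ⊙ e)))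
            ≈⟨ ∙-congˡ e* (polyApp-addV cs (p 1 ⊙ e) (scaleV κ′ (f ⊙ e))) ⟨
          e* ∙ polyApp cs τ (addV (p 1 ⊙ e) (scaleV κ′ (f ⊙ e))) ∎)
          where
          open ≈-Reasoning
          e*-gf : ∀ cs v → e* ∙ polyApp cs τ v ≈ e* ∙ (g ⊙ polyApp cs τ (f ⊙ v))
          e*-gf cs v = ∙-congˡ e* (transᵥ (symᵥ (gf (polyApp cs τ v))) (⊙-congˡ g (polyApp-central f-central cs v)))

      spanned : ∀ {ν} → ν * κ ≈ 1# → ∀ w → ∃₂ λ a b → w ≈ᵥ addV (scaleV a e) (scaleV b (f ⊙ e))
      spanned {ν} νκ≈1 w with e-gen w
      ... | cs , cs≈w = proj₁ (on-polyApp cs) , proj₁ (proj₂ (on-polyApp cs)) ,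
        transᵥ (symᵥ cs≈w) (proj₂ (proj₂ (on-polyApp cs)))
        where
        -- Dividing κ p_1 e = μ e by κ gives the scalar by which p_1 acts.
        α : Carrier
        α = ν * μ

        p1e : p 1 ⊙ e ≈ᵥ scaleV α e
        p1e i = begin
          (p 1 ⊙ e) i             ≈⟨ *-identityˡ _ ⟨
          1# * (p 1 ⊙ e) i        ≈⟨ *-congʳ νκ≈1 ⟨
          ν * κ * (p 1 ⊙ e) i     ≈⟨ *-assoc ν κ _ ⟩
          ν * (κ * (p 1 ⊙ e) i)   ≈⟨ *-congˡ (κp1e i) ⟩
          ν * (μ * e i)           ≈⟨ *-assoc ν μ (e i) ⟨
          ν * μ * e i             ∎
          where open ≈-Reasoning

        p1c : p 1 ⊙ (f ⊙ e) ≈ᵥ scaleV α (f ⊙ e)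
        p1c = begin
          p 1 ⊙ (f ⊙ e)      ≈⟨ central-comm′ (p-central 1) f-central e ⟩
          f ⊙ (p 1 ⊙ e)      ≈⟨ ⊙-congˡ f p1e ⟩
          f ⊙ scaleV α e     ≈⟨ ⊙-scaleV f α e ⟩
          scaleV α (f ⊙ e)        ∎
          where open ≈ᵥ-Reasoning

        on-polyApp : ∀ cs → ∃₂ λ a b → polyApp cs τ e ≈ᵥ addV (scaleV a e) (scaleV b (f ⊙ e))
        on-polyApp [] = 0# , 0# , λ i →
          sym (trans (+-cong (zeroˡ (e i)) (zeroˡ ((f ⊙ e) i))) (+-identityʳ 0#))
        on-polyApp (d ∷ cs) with on-polyApp cs
        -- The coefficients come from τ e = α e + κ′ c and τ c = α c + κ e.
        ... | a , b , ih = d + (a * α + b * κ) , a * κ′ + b * α , λ i → begin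
          d * e i + (τ ⊙ polyApp cs τ e) i ≈⟨ +-congˡ (step i) ⟩
          d * e i + (a * (α * e i + κ′ * (f ⊙ e) i) + b * (α * (f ⊙ e) i + κ * e i))
            ≈⟨ solve 8 (λ d x y a b α κ κ′ → d :* x :+ (a :* (α :* x :+ κ′ :* y) :+ b :* (α :* y :+ κ :* x))
                 := (d :+ (a :* α :+ b :* κ)) :* x :+ (a :* κ′ :+ b :* α) :* y) refl d (e i) ((f ⊙ e) i) a b α κ κ′ ⟩
          (d + (a * α + b * κ)) * e i + (a * κ′ + b * α) * (f ⊙ e) i ∎
          where
          open ≈-Reasoning
          step : τ ⊙ polyApp cs τ e ≈ᵥ λ i → a * (α * e i + κ′ * (f ⊙ e) i) + b * (α * (f ⊙ e) i + κ * e i)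
          step i = begin
            (τ ⊙ polyApp cs τ e) i                          ≈⟨ ⊙-congˡ τ ih i ⟩
            (τ ⊙ addV (scaleV a e) (scaleV b (f ⊙ e))) i
              ≈⟨ ⊙-addV τ (scaleV a e) (scaleV b (f ⊙ e)) i ⟩
            (τ ⊙ scaleV a e) i + (τ ⊙ scaleV b (f ⊙ e)) i
              ≈⟨ +-cong (⊙-scaleV τ a e i) (⊙-scaleV τ b (f ⊙ e) i) ⟩
            a * (τ ⊙ e) i + b * (τ ⊙ (f ⊙ e)) i
              ≈⟨ +-cong (*-congˡ (trans (sym (τe i)) (+-congʳ (p1e i)))) (*-congˡ (trans (sym (τc i)) (+-congʳ (p1c i)))) ⟩
            a * (α * e i + κ′ * (f ⊙ e) i) + b * (α * (f ⊙ e) i + κ * e i) ∎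

    module _ {ν} (νλ≈1 : ν * e* ∙ (f ⊙ e) ≈ 1#) where

      private
        p0c : addV (p 0 ⊙ (f ⊙ e)) (scaleV (e* ∙ (f ⊙ e)) e) ≈ᵥ (f ⊙ e)
        p0c i = trans (+-congʳ (sym (τH^-column 0 i))) (1H-split (f ⊙ e) i)

        -- Apply `p 0` to c = p_0 c + λ e: as p_0 is idempotent on c by `p-+` at zero, the term λ
        -- p_0 e must vanish.
        λp0e : scaleV (e* ∙ (f ⊙ e)) (p 0 ⊙ e) ≈ᵥ zeroV
        λp0e i = +-cancelˡ ((p 0 ⊙ (f ⊙ e)) i) _ _ (begin
          (p 0 ⊙ (f ⊙ e)) i + e* ∙ (f ⊙ e) * (p 0 ⊙ e) i
            ≈⟨ +-cong (p-+ 0 0 i) (⊙-scaleV (p 0) (e* ∙ (f ⊙ e)) e i) ⟨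
          (p 0 ⊙ (p 0 ⊙ (f ⊙ e))) i + (p 0 ⊙ scaleV (e* ∙ (f ⊙ e)) e) i
            ≈⟨ ⊙-addV (p 0) (p 0 ⊙ (f ⊙ e)) (scaleV (e* ∙ (f ⊙ e)) e) i ⟨
          (p 0 ⊙ addV (p 0 ⊙ (f ⊙ e)) (scaleV (e* ∙ (f ⊙ e)) e)) i      ≈⟨ ⊙-congˡ (p 0) p0c i ⟩
          (p 0 ⊙ (f ⊙ e)) i                                        ≈⟨ +-identityʳ _ ⟨
          (p 0 ⊙ (f ⊙ e)) i + 0#                                   ∎)
          where open ≈-Reasoning

        p0e : p 0 ⊙ e ≈ᵥ zeroV
        p0e i = begin
          (p 0 ⊙ e) i                  ≈⟨ *-identityˡ _ ⟨
          1# * (p 0 ⊙ e) i             ≈⟨ *-congʳ νλ≈1 ⟨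
          ν * e* ∙ (f ⊙ e) * (p 0 ⊙ e) i    ≈⟨ *-assoc ν (e* ∙ (f ⊙ e)) _ ⟩
          ν * (e* ∙ (f ⊙ e) * (p 0 ⊙ e) i)  ≈⟨ *-congˡ (λp0e i) ⟩
          ν * 0#                       ≈⟨ zeroʳ ν ⟩
          0#                           ∎
          where open ≈-Reasoning

        p0≈0 : ∀ w → p 0 ⊙ w ≈ᵥ zeroV
        p0≈0 w with e-gen w
        ... | cs , cs≈w = begin
          p 0 ⊙ w                  ≈⟨ ⊙-congˡ (p 0) cs≈w ⟨
          p 0 ⊙ polyApp cs τ e     ≈⟨ polyApp-central (p-central 0) cs e ⟩
          polyApp cs τ (p 0 ⊙ e)   ≈⟨ polyApp-cong cs p0e ⟩
          polyApp cs τ zeroV       ≈⟨ polyApp-zeroV cs ⟩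
          zeroV                    ∎
          where open ≈ᵥ-Reasoning

      column-proportional : (f ⊙ e) ≈ᵥ scaleV (e* ∙ (f ⊙ e)) e
      column-proportional i = trans (sym (p0c i))
        (trans (+-congʳ (p0≈0 (f ⊙ e) i)) (+-identityˡ _))

      -- The row relation at zero together with p_0 = 0 shows that b vanishes on V_H, so only the
      -- component of w along e contributes.
      row-proportional : ∀ w → e* ∙ (g ⊙ w) ≈ e* ∙ w * e* ∙ (g ⊙ e)
      row-proportional w = begin
        e* ∙ (g ⊙ w)                                       ≈⟨ ∙-congˡ e* (⊙-congˡ g (1H-split w)) ⟨
        e* ∙ (g ⊙ addV (1H ⊙ w) (scaleV (e* ∙ w) e))
          ≈⟨ ∙-congˡ e* (⊙-addV g (1H ⊙ w) (scaleV (e* ∙ w) e)) ⟩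
        e* ∙ addV (g ⊙ (1H ⊙ w)) (g ⊙ scaleV (e* ∙ w) e)   ≈⟨ ∙-addV e* _ _ ⟩
        e* ∙ (g ⊙ (1H ⊙ w)) + e* ∙ (g ⊙ scaleV (e* ∙ w) e)
          ≈⟨ +-cong (trans (τH^-row 0 w) (∙-congˡ e* (transᵥ (⊙-congˡ g (p0≈0 w)) (⊙-zeroV g))))
               (trans (∙-congˡ e* (⊙-scaleV g (e* ∙ w) e)) (∙-scaleV e* (e* ∙ w) (g ⊙ e))) ⟩
        e* ∙ zeroV + e* ∙ w * e* ∙ (g ⊙ e)
          ≈⟨ trans (+-congʳ (∙-zeroV e*)) (+-identityˡ _) ⟩
        e* ∙ w * e* ∙ (g ⊙ e)                              ∎
        where open ≈-Reasoning

  -- If V were spanned by two vectors, the identity matrix of size 3 would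
  -- factor through rank 2; equating the even and odd halves of its
  -- determinant gives 1 = 0.
  span₂⇒trivial : n ≥ 3 → ∀ (v w : Vect n) → (∀ u → ∃₂ λ a b → u ≈ᵥ addV (scaleV a v) (scaleV b w)) → 1# ≈ 0#
  span₂⇒trivial (s≤s (s≤s (s≤s z≤n))) v w span = begin
    1#      ≈⟨ even≈1 ⟨
    even    ≈⟨ +-cong (+-cong (d 0F 0F 1F 1F 2F 2F) (d 0F 1F 1F 2F 2F 0F)) (d 0F 2F 1F 0F 2F 1F) ⟩
    _ ≈⟨ solve 12 (λ a₀ a₁ a₂ b₀ b₁ b₂ v₀ v₁ v₂ w₀ w₁ w₂ →
           (a₀ :* v₀ :+ b₀ :* w₀) :* (a₁ :* v₁ :+ b₁ :* w₁) :* (a₂ :* v₂ :+ b₂ :* w₂) :+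
           (a₀ :* v₁ :+ b₀ :* w₁) :* (a₁ :* v₂ :+ b₁ :* w₂) :* (a₂ :* v₀ :+ b₂ :* w₀) :+
           (a₀ :* v₂ :+ b₀ :* w₂) :* (a₁ :* v₀ :+ b₁ :* w₀) :* (a₂ :* v₁ :+ b₂ :* w₁) :=
           (a₀ :* v₂ :+ b₀ :* w₂) :* (a₁ :* v₁ :+ b₁ :* w₁) :* (a₂ :* v₀ :+ b₂ :* w₀) :+
           (a₀ :* v₀ :+ b₀ :* w₀) :* (a₁ :* v₂ :+ b₁ :* w₂) :* (a₂ :* v₁ :+ b₂ :* w₁) :+
           (a₀ :* v₁ :+ b₀ :* w₁) :* (a₁ :* v₀ :+ b₁ :* w₀) :* (a₂ :* v₂ :+ b₂ :* w₂)) refl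
           (a 0F) (a 1F) (a 2F) (b 0F) (b 1F) (b 2F) (v 0F) (v 1F) (v 2F) (w 0F) (w 1F) (w 2F) ⟩
    _       ≈⟨ +-cong (+-cong (d 0F 2F 1F 1F 2F 0F) (d 0F 0F 1F 2F 2F 1F)) (d 0F 1F 1F 0F 2F 2F) ⟨
    odd     ≈⟨ odd≈0 ⟩
    0#      ∎
    where
    open ≈-Reasoning
    pattern 0F = zero
    pattern 1F = suc zero
    pattern 2F = suc (suc zero)
    a b : Fin n → Carrier
    a i = proj₁ (span (idM i))
    b i = proj₁ (proj₂ (span (idM i)))
    δ : ∀ i j → idM i j ≈ a i * v j + b i * w j
    δ i = proj₂ (proj₂ (span (idM i)))
    d : ∀ i i′ j j′ k k′ → idM i i′ * idM j j′ * idM k k′ ≈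
      (a i * v i′ + b i * w i′) * (a j * v j′ + b j * w j′) * (a k * v k′ + b k * w k′)
    d i i′ j j′ k k′ = *-cong (*-cong (δ i i′) (δ j j′)) (δ k k′)
    even odd : Carrier
    even = idM {n} 0F 0F * idM {n} 1F 1F * idM {n} 2F 2F + idM {n} 0F 1F * idM {n} 1F 2F * idM {n} 2F 0F + idM {n} 0F 2F * idM {n} 1F 0F * idM {n} 2F 1F
    odd  = idM {n} 0F 2F * idM {n} 1F 1F * idM {n} 2F 0F + idM {n} 0F 0F * idM {n} 1F 2F * idM {n} 2F 1F + idM {n} 0F 1F * idM {n} 1F 0F * idM {n} 2F 2F
    -- The dimension has been exposed as three successors plus a rest, so these entries of `idM`
    -- compute to the solver's constants 0 and 1.
    even≈1 : even ≈ 1#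
    even≈1 = solve 0 (con 1 :* con 1 :* con 1 :+ con 0 :* con 0 :* con 0 :+ con 0 :* con 0 :* con 0 := con 1) refl
    odd≈0 : odd ≈ 0#
    odd≈0 = solve 0 (con 0 :* con 1 :* con 0 :+ con 1 :* con 0 :* con 0 :+ con 0 :* con 0 :* con 1 := con 0) refl

-- Passage to quotient rings

module Coarsening {c ℓ ℓ′ ℓ″} (A : RawRing c ℓ)
  (_~_ : Rel (RawRing.Carrier A) ℓ′)
  (isCommutativeRing : CommutativeRingFor A _~_)
  (_≃_ : Rel (RawRing.Carrier A) ℓ″)
  (coarse-isCommutativeRing : CommutativeRingFor A _≃_)
  (~⇒≃ : ∀ {x y} → x ~ y → x ≃ y) where

  open RawRing A using (Carrier; _+_; _*_; -_; 0#; 1#)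

  module _ {n} {e e* : Lin.Vect A n} {τ : Lin.Mat A n} where
    private
      module Fine   = Rigidity A _~_ isCommutativeRing e e* τ
      module Coarse = Rigidity A _≃_ coarse-isCommutativeRing e e* τ

    -- Every field is an equation, or an explicit polynomial together with an equation, so the same
    -- data remain valid for a coarser equality.
    coarsen : ∀ {f g p} → Fine.Intertwined f g p → Coarse.Intertwined f g p
    coarsen I = record
      { e*e≈1      = ~⇒≃ e*e≈1
      ; e-gen      = λ w → proj₁ (e-gen w) , λ i → ~⇒≃ (proj₂ (e-gen w) i)
      ; e*-gen     = λ w → proj₁ (e*-gen w) , λ i → ~⇒≃ (proj₂ (e*-gen w) i)
      ; f-central  = λ w i → ~⇒≃ (f-central w i)
      ; g-central  = λ w i → ~⇒≃ (g-central w i)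
      ; p-central  = λ k w i → ~⇒≃ (p-central k w i)
      ; fg         = λ w i → ~⇒≃ (fg w i)
      ; gf         = λ w i → ~⇒≃ (gf w i)
      ; τH^-column = λ k i → ~⇒≃ (τH^-column k i)
      ; τH^-row    = λ k w → ~⇒≃ (τH^-row k w)
      ; p-+        = λ j k i → ~⇒≃ (p-+ j k i) }
      where open Fine.Intertwined I

module Modulo {c ℓ ℓ′} (A : RawRing c ℓ)
  (_~_ : Rel (RawRing.Carrier A) ℓ′)
  (isCommutativeRing : CommutativeRingFor A _~_)
  (m : RawRing.Carrier A) where

  open RawRing A using (Carrier; _+_; _*_; -_; 0#; 1#)

  open LinearAlgebra A _~_ isCommutativeRing
  open NaturalSolver commutativeSemiring using (solve; _:=_; _:+_; _:*_)

  infix 4 _≈ₘ_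

  -- Equality in the quotient by the principal ideal of m, relative to an equality that may itself
  -- be such a congruence. Since the multiplier is recorded, a proof that 1 is congruent to 0
  -- contains an inverse of m.
  record _≈ₘ_ (x y : Carrier) : Set (c ⊔ ℓ′) where
    constructor congruent
    field
      quotient : Carrier
      proof    : x ≈ y + m * quotient

  ≈⇒≈ₘ : ∀ {x y} → x ≈ y → x ≈ₘ y
  ≈⇒≈ₘ x≈y = congruent 0# (trans x≈y (sym (trans (+-congˡ (zeroʳ m)) (+-identityʳ _))))

  m≈ₘ0 : m ≈ₘ 0#
  m≈ₘ0 = congruent 1# (sym (trans (+-identityˡ _) (*-identityʳ m)))

  ≈ₘ-isEquivalence : IsEquivalence _≈ₘ_
  ≈ₘ-isEquivalence = record
    { refl  = ≈⇒≈ₘ refl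
    ; sym   = λ { {x} {y} (congruent r p) → congruent (- r) (begin
        y                         ≈⟨ +-identityʳ y ⟨
        y + 0#                    ≈⟨ +-congˡ (trans (*-congˡ (-‿inverseʳ r)) (zeroʳ m)) ⟨
        y + m * (r + - r)
          ≈⟨ solve 4 (λ y m r s → y :+ m :* (r :+ s) := y :+ m :* r :+ m :* s) refl y m r (- r) ⟩
        y + m * r + m * - r       ≈⟨ +-congʳ p ⟨
        x + m * - r               ∎) }
    ; trans = λ { {x} {y} {z} (congruent r p) (congruent s q) → congruent (s + r) (begin
        x                         ≈⟨ p ⟩
        y + m * r                 ≈⟨ +-congʳ q ⟩
        z + m * s + m * r
          ≈⟨ solve 4 (λ z m r s → z :+ m :* s :+ m :* r := z :+ m :* (s :+ r)) refl z m r s ⟩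
        z + m * (s + r)           ∎) } }
    where open ≈-Reasoning

  +-congₘ : Congruent₂ _≈ₘ_ _+_
  +-congₘ {x} {y} {u} {v} (congruent r p) (congruent s q) = congruent (r + s) (trans (+-cong p q)
    (solve 5 (λ y v m r s → y :+ m :* r :+ (v :+ m :* s) := y :+ v :+ m :* (r :+ s)) refl y v m r s))

  *-congₘ : Congruent₂ _≈ₘ_ _*_
  *-congₘ {x} {y} {u} {v} (congruent r p) (congruent s q) = congruent (y * s + r * v + r * (m * s)) (trans (*-cong p q)
    (solve 5 (λ y v m r s → (y :+ m :* r) :* (v :+ m :* s) := y :* v :+ m :* (y :* s :+ r :* v :+ r :* (m :* s)))
      refl y v m r s))

  -‿congₘ : Congruent₁ _≈ₘ_ -_
  -‿congₘ {x} {y} (congruent r p) = congruent (- r) (trans (-‿cong p)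
    (trans (sym (-‿+-comm y (m * r))) (+-congˡ (-‿distribʳ-* m r))))

  abstract
    ≈ₘ-isCommutativeRing : CommutativeRingFor A _≈ₘ_
    ≈ₘ-isCommutativeRing = record
      { isRing = record
        { +-isAbelianGroup = record
          { isGroup = record
            { isMonoid = record
              { isSemigroup = record
                { isMagma = record { isEquivalence = ≈ₘ-isEquivalence ; ∙-cong = +-congₘ }
                ; assoc = λ x y z → ≈⇒≈ₘ (+-assoc x y z) }
              ; identity = (λ x → ≈⇒≈ₘ (+-identityˡ x)) , (λ x → ≈⇒≈ₘ (+-identityʳ x)) }
            ; inverse = (λ x → ≈⇒≈ₘ (-‿inverseˡ x)) , (λ x → ≈⇒≈ₘ (-‿inverseʳ x))
            ; ⁻¹-cong = -‿congₘ }
          ; comm = λ x y → ≈⇒≈ₘ (+-comm x y) }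
        ; *-cong = *-congₘ
        ; *-assoc = λ x y z → ≈⇒≈ₘ (*-assoc x y z)
        ; *-identity = (λ x → ≈⇒≈ₘ (*-identityˡ x)) , (λ x → ≈⇒≈ₘ (*-identityʳ x))
        ; distrib = (λ x y z → ≈⇒≈ₘ (distribˡ x y z)) , (λ x y z → ≈⇒≈ₘ (distribʳ x y z)) }
      ; *-comm = λ x y → ≈⇒≈ₘ (*-comm x y) }

  open Coarsening A _~_ isCommutativeRing _≈ₘ_ ≈ₘ-isCommutativeRing ≈⇒≈ₘ public

-- Invertibility of λ

module Scalarity {c ℓ ℓ′} (A : RawRing c ℓ)
  (_~_ : Rel (RawRing.Carrier A) ℓ′)
  (isCommutativeRing : CommutativeRingFor A _~_)
  {n} (n≥3 : n ≥ 3) (e e* : Lin.Vect A n) (τ : Lin.Mat A n) where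

  open RawRing A using (Carrier; _+_; _*_; -_; 0#; 1#)

  open LinearAlgebra A _~_ isCommutativeRing
  open MatrixOperations A hiding (module Corner)
  open Rigidity A _~_ isCommutativeRing e e* τ

  -- Working modulo λ = e*(c), and there modulo κ = e*(τ c): the latter
  -- quotient is trivial, so κ is invertible modulo λ.
  module _ {f g p} (I : Intertwined f g p) where

    λ-invertible : ∃ λ ν → ν * e* ∙ (f ⊙ e) ≈ 1#
    -- The congruence 1 = 0 modulo λ unfolds to 1 = 0 + λ ν, which yields ν; the inverse of κ modulo
    -- λ is extracted below in the same way.
    λ-invertible = M._≈ₘ_.quotient 1≈ₘ0 , trans (*-comm _ _) (trans (sym (+-identityˡ _)) (sym (M._≈ₘ_.proof 1≈ₘ0)))
      where
      λ₀ κ : Carrier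
      λ₀ = e* ∙ (f ⊙ e)
      κ  = e* ∙ (τ ⊙ (f ⊙ e))
      module M = Modulo A _~_ isCommutativeRing λ₀
      module N = Modulo A M._≈ₘ_ M.≈ₘ-isCommutativeRing κ
      module RM = Rigidity A M._≈ₘ_ M.≈ₘ-isCommutativeRing e e* τ
      module RN = Rigidity A N._≈ₘ_ N.≈ₘ-isCommutativeRing e e* τ
      module LM = LinearAlgebra A M._≈ₘ_ M.≈ₘ-isCommutativeRing
      IM = M.coarsen I
      κ-invertible : ∃ λ ν → (ν * κ) M.≈ₘ 1#
      κ-invertible with RN.e*c,e*τc≈0⇒trivial (N.coarsen IM) (N.≈⇒≈ₘ M.m≈ₘ0) N.m≈ₘ0
      ... | N.congruent ν p = ν , LM.trans (LM.*-comm ν κ) (LM.trans (LM.sym (LM.+-identityˡ _)) (LM.sym p))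
      1≈ₘ0 : 1# M.≈ₘ 0#
      1≈ₘ0 = RM.span₂⇒trivial n≥3 e (f ⊙ e) (RM.spanned IM M.m≈ₘ0 (proj₂ κ-invertible))

-- The homomorphism from ℤ to R

module IntegerImage {c ℓ} (R : CommutativeRing c ℓ) where

  open CommutativeRing R using (rawRing; isCommutativeRing; _+_; _*_; -_; 0#; 1#; semiring)
  open LinearAlgebra rawRing (CommutativeRing._≈_ R) isCommutativeRing
  open MatrixOperations rawRing
  open NaturalSolver commutativeSemiring using (solve; _:=_; _:+_; _:*_; con)
  open Mult semiring using (×-homo-+; ×1-homo-*) renaming (_×_ to _×ₙ_)
  open ≈-Reasoning

  natR≡×1 : ∀ k → natR k ≡ k ×ₙ 1#
  natR≡×1 zero    = ≡.refl
  natR≡×1 (suc k) = ≡.cong (λ r → 1# + r) (natR≡×1 k)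

  natR-+ : ∀ j k → natR (j ℕ.+ k) ≈ natR j + natR k
  natR-+ j k rewrite natR≡×1 (j ℕ.+ k) | natR≡×1 j | natR≡×1 k = ×-homo-+ 1# j k

  natR-* : ∀ j k → natR (j ℕ.* k) ≈ natR j * natR k
  natR-* j k rewrite natR≡×1 (j ℕ.* k) | natR≡×1 j | natR≡×1 k = ×1-homo-* j k

  intR-⊖ : ∀ j k → intR (j ℤ.⊖ k) ≈ natR j + - natR k
  intR-⊖ zero    zero    = sym (-‿inverseʳ 0#)
  intR-⊖ zero    (suc k) = sym (+-identityˡ _)
  intR-⊖ (suc j) zero    = sym (trans (+-congˡ -0#≈0#) (+-identityʳ _))
  intR-⊖ (suc j) (suc k) = begin
    intR (suc j ℤ.⊖ suc k)              ≡⟨ ≡.cong intR (ℤ.[1+m]⊖[1+n]≡m⊖n j k) ⟩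
    intR (j ℤ.⊖ k)                      ≈⟨ intR-⊖ j k ⟩
    natR j + - natR k                   ≈⟨ +-identityˡ _ ⟨
    0# + (natR j + - natR k)            ≈⟨ +-congʳ (-‿inverseʳ 1#) ⟨
    1# + - 1# + (natR j + - natR k)
      ≈⟨ solve 3 (λ o x y → con 1 :+ o :+ (x :+ y) := con 1 :+ x :+ (o :+ y)) refl (- 1#) (natR j) (- natR k) ⟩
    1# + natR j + (- 1# + - natR k)     ≈⟨ +-congˡ (-‿+-comm 1# (natR k)) ⟩
    natR (suc j) + - natR (suc k)       ∎

  intR-+ : ∀ x y → intR (x ℤ.+ y) ≈ intR x + intR y
  intR-+ (+ j)    (+ k)    = natR-+ j k
  intR-+ (+ j)    -[1+ k ] = intR-⊖ j (suc k)
  intR-+ -[1+ j ] (+ k)    = trans (intR-⊖ k (suc j)) (+-comm _ _)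
  intR-+ -[1+ j ] -[1+ k ] = begin
    - natR (suc (suc (j ℕ.+ k)))        ≡⟨ ≡.cong (λ m → - natR (suc m)) (ℕ.+-suc j k) ⟨
    - natR (suc j ℕ.+ suc k)            ≈⟨ -‿cong (natR-+ (suc j) (suc k)) ⟩
    - (natR (suc j) + natR (suc k))     ≈⟨ -‿+-comm _ _ ⟨
    - natR (suc j) + - natR (suc k)     ∎

  -- Products of mixed sign are normalised through `◃`, which sends a negative sign with absolute
  -- value zero to + 0; hence the separate case.
  intR-◃- : ∀ k → intR (Sign.- ℤ.◃ k) ≈ - natR k
  intR-◃- zero    = sym -0#≈0#
  intR-◃- (suc k) = refl

  intR-◃+ : ∀ k → intR (Sign.+ ℤ.◃ k) ≈ natR k
  intR-◃+ k = reflexive (≡.cong intR (ℤ.+◃n≡+n k))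

  intR-* : ∀ x y → intR (x ℤ.* y) ≈ intR x * intR y
  intR-* (+ j)    (+ k)    = trans (intR-◃+ (j ℕ.* k)) (natR-* j k)
  intR-* (+ j)    -[1+ k ] = trans (intR-◃- (j ℕ.* suc k))
    (trans (-‿cong (natR-* j (suc k))) (-‿distribʳ-* _ _))
  intR-* -[1+ j ] (+ k)    = trans (intR-◃- (suc j ℕ.* k))
    (trans (-‿cong (natR-* (suc j) k)) (-‿distribˡ-* _ _))
  intR-* -[1+ j ] -[1+ k ] = begin
    natR (suc j ℕ.* suc k)                  ≈⟨ natR-* (suc j) (suc k) ⟩
    natR (suc j) * natR (suc k)             ≈⟨ -‿involutive _ ⟨
    - (- (natR (suc j) * natR (suc k)))     ≈⟨ -‿cong (-‿distribʳ-* _ _) ⟩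
    - (natR (suc j) * - natR (suc k))       ≈⟨ -‿distribˡ-* _ _ ⟩
    - natR (suc j) * - natR (suc k)         ∎

  -- Transports the integral normalisation e*(e) = 1 to R.
  intR-pairℤ : ∀ {n} (l v : Fin n → ℤ) → (λ i → intR (l i)) ∙ (λ i → intR (v i)) ≈ intR (pairℤ l v)
  intR-pairℤ {zero}  l v = refl
  intR-pairℤ {suc n} l v = sym (trans (intR-+ (l zero ℤ.* v zero) _)
    (+-cong (intR-* (l zero) (v zero)) (sym (intR-pairℤ (λ i → l (suc i)) (λ i → v (suc i))))))

-- The ring R'' of dual numbers in two variables

module DualNumbers {c ℓ} (R : CommutativeRing c ℓ) where

  open CommutativeRing R using (rawRing; isCommutativeRing; _+_; _*_; -_; 0#; 1#)
  open LinearAlgebra rawRing (CommutativeRing._≈_ R) isCommutativeRing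
  open MatrixOperations rawRing
  open NaturalSolver commutativeSemiring using (solve; _:=_; _:+_; _:*_; con)
  open Dual2 rawRing

  abstract
    -- In the multiplicative laws the components at ε₁ and at ε₂ both behave as in dual numbers of
    -- one variable and share the helpers with subscript 1; only the component at ε₁ε₂ needs
    -- identities of its own.
    isCommutativeRing'' : CommutativeRingFor R'' (RawRing._≈_ R'')
    isCommutativeRing'' = record
      { isRing = record
        { +-isAbelianGroup = record
          { isGroup = record
            { isMonoid = record
              { isSemigroup = record
                { isMagma = record
                  { isEquivalence = record
                    { refl  = refl , refl , refl , refl
                    ; sym   = λ (p , q , r , s) → sym p , sym q , sym r , sym s
                    ; trans = λ (p , q , r , s) (p′ , q′ , r′ , s′) →
                        trans p p′ , trans q q′ , trans r r′ , trans s s′ }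
                  ; ∙-cong = λ (p , q , r , s) (p′ , q′ , r′ , s′) →
                      +-cong p p′ , +-cong q q′ , +-cong r r′ , +-cong s s′ }
                ; assoc = λ x y z → +-assoc _ _ _ , +-assoc _ _ _ , +-assoc _ _ _ , +-assoc _ _ _ }
              ; identity = (λ x → +-identityˡ _ , +-identityˡ _ , +-identityˡ _ , +-identityˡ _)
                         , (λ x → +-identityʳ _ , +-identityʳ _ , +-identityʳ _ , +-identityʳ _) }
            ; inverse = (λ x → -‿inverseˡ _ , -‿inverseˡ _ , -‿inverseˡ _ , -‿inverseˡ _)
                      , (λ x → -‿inverseʳ _ , -‿inverseʳ _ , -‿inverseʳ _ , -‿inverseʳ _)
            ; ⁻¹-cong = λ (p , q , r , s) → -‿cong p , -‿cong q , -‿cong r , -‿cong s }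
          ; comm = λ x y → +-comm _ _ , +-comm _ _ , +-comm _ _ , +-comm _ _ }
        ; *-cong = λ (p , q , r , s) (p′ , q′ , r′ , s′) →
            *-cong p p′
          , +-cong (*-cong p q′) (*-cong q p′)
          , +-cong (*-cong p r′) (*-cong r p′)
          , +-cong (+-cong (+-cong (*-cong p s′) (*-cong q r′)) (*-cong r q′)) (*-cong s p′)
        ; *-assoc = λ (d2 x₀ x₁ x₂ x₃) (d2 y₀ y₁ y₂ y₃) (d2 z₀ z₁ z₂ z₃) →
            *-assoc x₀ y₀ z₀
          , assoc₁ x₀ x₁ y₀ y₁ z₀ z₁
          , assoc₁ x₀ x₂ y₀ y₂ z₀ z₂
          , solve 12 (λ x₀ x₁ x₂ x₃ y₀ y₁ y₂ y₃ z₀ z₁ z₂ z₃ →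
              x₀ :* y₀ :* z₃ :+ (x₀ :* y₁ :+ x₁ :* y₀) :* z₂ :+ (x₀ :* y₂ :+ x₂ :* y₀) :* z₁
                :+ (x₀ :* y₃ :+ x₁ :* y₂ :+ x₂ :* y₁ :+ x₃ :* y₀) :* z₀ :=
              x₀ :* (y₀ :* z₃ :+ y₁ :* z₂ :+ y₂ :* z₁ :+ y₃ :* z₀) :+ x₁ :* (y₀ :* z₂ :+ y₂ :* z₀)
                :+ x₂ :* (y₀ :* z₁ :+ y₁ :* z₀) :+ x₃ :* (y₀ :* z₀)) refl
              x₀ x₁ x₂ x₃ y₀ y₁ y₂ y₃ z₀ z₁ z₂ z₃
        ; *-identity =
            (λ (d2 x₀ x₁ x₂ x₃) → *-identityˡ x₀ , identityˡ₁ x₀ x₁ , identityˡ₁ x₀ x₂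
              , solve 4 (λ x₀ x₁ x₂ x₃ → con 1 :* x₃ :+ con 0 :* x₂ :+ con 0 :* x₁ :+ con 0 :* x₀ := x₃) refl x₀ x₁ x₂ x₃)
          , (λ (d2 x₀ x₁ x₂ x₃) → *-identityʳ x₀ , identityʳ₁ x₀ x₁ , identityʳ₁ x₀ x₂
              , solve 4 (λ x₀ x₁ x₂ x₃ → x₀ :* con 0 :+ x₁ :* con 0 :+ x₂ :* con 0 :+ x₃ :* con 1 := x₃) refl x₀ x₁ x₂ x₃)
        ; distrib =
            (λ (d2 x₀ x₁ x₂ x₃) (d2 y₀ y₁ y₂ y₃) (d2 z₀ z₁ z₂ z₃) →
              distribˡ x₀ y₀ z₀ , distribˡ₁ x₀ x₁ y₀ y₁ z₀ z₁ , distribˡ₁ x₀ x₂ y₀ y₂ z₀ z₂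
            , solve 12 (λ x₀ x₁ x₂ x₃ y₀ y₁ y₂ y₃ z₀ z₁ z₂ z₃ →
                x₀ :* (y₃ :+ z₃) :+ x₁ :* (y₂ :+ z₂) :+ x₂ :* (y₁ :+ z₁) :+ x₃ :* (y₀ :+ z₀) :=
                (x₀ :* y₃ :+ x₁ :* y₂ :+ x₂ :* y₁ :+ x₃ :* y₀) :+ (x₀ :* z₃ :+ x₁ :* z₂ :+ x₂ :* z₁ :+ x₃ :* z₀)) refl
                x₀ x₁ x₂ x₃ y₀ y₁ y₂ y₃ z₀ z₁ z₂ z₃)
          , (λ (d2 x₀ x₁ x₂ x₃) (d2 y₀ y₁ y₂ y₃) (d2 z₀ z₁ z₂ z₃) →
              distribʳ x₀ y₀ z₀ , distribʳ₁ x₀ x₁ y₀ y₁ z₀ z₁ , distribʳ₁ x₀ x₂ y₀ y₂ z₀ z₂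
            , solve 12 (λ x₀ x₁ x₂ x₃ y₀ y₁ y₂ y₃ z₀ z₁ z₂ z₃ →
                (y₀ :+ z₀) :* x₃ :+ (y₁ :+ z₁) :* x₂ :+ (y₂ :+ z₂) :* x₁ :+ (y₃ :+ z₃) :* x₀ :=
                (y₀ :* x₃ :+ y₁ :* x₂ :+ y₂ :* x₁ :+ y₃ :* x₀) :+ (z₀ :* x₃ :+ z₁ :* x₂ :+ z₂ :* x₁ :+ z₃ :* x₀)) refl
                x₀ x₁ x₂ x₃ y₀ y₁ y₂ y₃ z₀ z₁ z₂ z₃) }
      ; *-comm = λ (d2 x₀ x₁ x₂ x₃) (d2 y₀ y₁ y₂ y₃) →
          *-comm x₀ y₀ , comm₁ x₀ x₁ y₀ y₁ , comm₁ x₀ x₂ y₀ y₂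
        , solve 8 (λ x₀ x₁ x₂ x₃ y₀ y₁ y₂ y₃ →
            x₀ :* y₃ :+ x₁ :* y₂ :+ x₂ :* y₁ :+ x₃ :* y₀ := y₀ :* x₃ :+ y₁ :* x₂ :+ y₂ :* x₁ :+ y₃ :* x₀) refl
            x₀ x₁ x₂ x₃ y₀ y₁ y₂ y₃ }
      where
      assoc₁ : ∀ x₀ x₁ y₀ y₁ z₀ z₁ →
        x₀ * y₀ * z₁ + (x₀ * y₁ + x₁ * y₀) * z₀ ≈ x₀ * (y₀ * z₁ + y₁ * z₀) + x₁ * (y₀ * z₀)
      assoc₁ = solve 6 (λ x₀ x₁ y₀ y₁ z₀ z₁ → x₀ :* y₀ :* z₁ :+ (x₀ :* y₁ :+ x₁ :* y₀) :* z₀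
        := x₀ :* (y₀ :* z₁ :+ y₁ :* z₀) :+ x₁ :* (y₀ :* z₀)) refl
      identityˡ₁ : ∀ x₀ x₁ → 1# * x₁ + 0# * x₀ ≈ x₁
      identityˡ₁ = solve 2 (λ x₀ x₁ → con 1 :* x₁ :+ con 0 :* x₀ := x₁) refl
      identityʳ₁ : ∀ x₀ x₁ → x₀ * 0# + x₁ * 1# ≈ x₁
      identityʳ₁ = solve 2 (λ x₀ x₁ → x₀ :* con 0 :+ x₁ :* con 1 := x₁) refl
      distribˡ₁ : ∀ x₀ x₁ y₀ y₁ z₀ z₁ →
        x₀ * (y₁ + z₁) + x₁ * (y₀ + z₀) ≈ (x₀ * y₁ + x₁ * y₀) + (x₀ * z₁ + x₁ * z₀)
      distribˡ₁ = solve 6 (λ x₀ x₁ y₀ y₁ z₀ z₁ → x₀ :* (y₁ :+ z₁) :+ x₁ :* (y₀ :+ z₀)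
        := (x₀ :* y₁ :+ x₁ :* y₀) :+ (x₀ :* z₁ :+ x₁ :* z₀)) refl
      distribʳ₁ : ∀ x₀ x₁ y₀ y₁ z₀ z₁ →
        (y₀ + z₀) * x₁ + (y₁ + z₁) * x₀ ≈ (y₀ * x₁ + y₁ * x₀) + (z₀ * x₁ + z₁ * x₀)
      distribʳ₁ = solve 6 (λ x₀ x₁ y₀ y₁ z₀ z₁ → (y₀ :+ z₀) :* x₁ :+ (y₁ :+ z₁) :* x₀
        := (y₀ :* x₁ :+ y₁ :* x₀) :+ (z₀ :* x₁ :+ z₁ :* x₀)) refl
      comm₁ : ∀ x₀ x₁ y₀ y₁ → x₀ * y₁ + x₁ * y₀ ≈ y₀ * x₁ + y₁ * x₀
      comm₁ = solve 4 (λ x₀ x₁ y₀ y₁ → x₀ :* y₁ :+ x₁ :* y₀ := y₀ :* x₁ :+ y₁ :* x₀) refl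

  commutativeRing'' : CommutativeRing c ℓ
  commutativeRing'' = record { isCommutativeRing = isCommutativeRing'' }

-- The groups G, H and Z

module LinearGroups {c ℓ} (R : CommutativeRing c ℓ) where

  open CommutativeRing R using (rawRing; isCommutativeRing; _*_; 1#)
  open LinearAlgebra rawRing (CommutativeRing._≈_ R) isCommutativeRing
  open MatrixOperations rawRing
  open Lin rawRing using (InG; _≈ₘ_; module WithE)

  inverse-⊙ : ∀ {n} {x y : Mat n} → (x · y) ≈ₘ idM → ∀ w → x ⊙ (y ⊙ w) ≈ᵥ w
  inverse-⊙ {x = x} {y} xy≈1 w = transᵥ (symᵥ (·-⊙ x y w)) (transᵥ (⊙-congʳ xy≈1 w) (⊙-identity w))

  ⊙-inverse : ∀ {n} {x y : Mat n} → (∀ w → x ⊙ (y ⊙ w) ≈ᵥ w) → (x · y) ≈ₘ idM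
  ⊙-inverse {x = x} {y} xy≈1 = ⊙-injective λ w →
    transᵥ (·-⊙ x y w) (transᵥ (xy≈1 w) (symᵥ (⊙-identity w)))

  InG-· : ∀ {n} {x y : Mat n} → InG x → InG y → InG (x · y)
  InG-· {x = x} {y} (x⁻¹ , xx⁻¹ , x⁻¹x) (y⁻¹ , yy⁻¹ , y⁻¹y) = y⁻¹ · x⁻¹
    , ⊙-inverse (λ w → transᵥ (·-⊙ x y _) (transᵥ (⊙-congˡ x (transᵥ (⊙-congˡ y (·-⊙ y⁻¹ x⁻¹ w))
        (inverse-⊙ yy⁻¹ (x⁻¹ ⊙ w)))) (inverse-⊙ xx⁻¹ w)))
    , ⊙-inverse (λ w → transᵥ (·-⊙ y⁻¹ x⁻¹ _) (transᵥ (⊙-congˡ y⁻¹ (transᵥ (⊙-congˡ x⁻¹ (·-⊙ x y w))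
        (inverse-⊙ x⁻¹x (y ⊙ w)))) (inverse-⊙ y⁻¹y w)))

  ·-commute : ∀ {n} {x z : Mat n} → (x · z) ≈ₘ (z · x) → ∀ w → x ⊙ (z ⊙ w) ≈ᵥ z ⊙ (x ⊙ w)
  ·-commute {x = x} {z} xz≈zx w = transᵥ (symᵥ (·-⊙ x z w)) (transᵥ (⊙-congʳ xz≈zx w) (·-⊙ z x w))

  commute-· : ∀ {n} {x z : Mat n} → (∀ w → x ⊙ (z ⊙ w) ≈ᵥ z ⊙ (x ⊙ w)) → (x · z) ≈ₘ (z · x)
  commute-· {x = x} {z} xz≈zx = ⊙-injective λ w →
    transᵥ (·-⊙ x z w) (transᵥ (xz≈zx w) (symᵥ (·-⊙ z x w)))

  inverse-commute : ∀ {n} {x x⁻¹ z : Mat n} → (x · x⁻¹) ≈ₘ idM → (x⁻¹ · x) ≈ₘ idM →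
    (x · z) ≈ₘ (z · x) → ∀ w → x⁻¹ ⊙ (z ⊙ w) ≈ᵥ z ⊙ (x⁻¹ ⊙ w)
  inverse-commute {x = x} {x⁻¹} {z} xx⁻¹ x⁻¹x xz≈zx w = begin
    x⁻¹ ⊙ (z ⊙ w)                ≈⟨ ⊙-congˡ x⁻¹ (⊙-congˡ z (inverse-⊙ xx⁻¹ w)) ⟨
    x⁻¹ ⊙ (z ⊙ (x ⊙ (x⁻¹ ⊙ w)))  ≈⟨ ⊙-congˡ x⁻¹ (·-commute xz≈zx (x⁻¹ ⊙ w)) ⟨
    x⁻¹ ⊙ (x ⊙ (z ⊙ (x⁻¹ ⊙ w)))  ≈⟨ inverse-⊙ x⁻¹x (z ⊙ (x⁻¹ ⊙ w)) ⟩
    z ⊙ (x⁻¹ ⊙ w)                ∎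
    where open ≈ᵥ-Reasoning

  scalarM-inverse : ∀ {n r s} → r * s ≈ 1# → (scalarM {n} r · scalarM s) ≈ₘ idM
  scalarM-inverse {r = r} {s} rs≈1 = ⊙-inverse λ w → transᵥ (scalarM-⊙ r (scalarM s ⊙ w)) λ i →
    trans (*-congˡ (scalarM-⊙ s w i)) (trans (sym (*-assoc r s (w i))) (trans (*-congʳ rs≈1) (*-identityˡ (w i))))

  scalarM-InG : ∀ {n r} → Lin.IsUnit rawRing r → InG (scalarM {n} r)
  scalarM-InG (s , rs≈1) = scalarM s , scalarM-inverse rs≈1 , scalarM-inverse (trans (*-comm s _) rs≈1)

  scalarM-central : ∀ {n} r (x : Mat n) → (scalarM r · x) ≈ₘ (x · scalarM r)
  scalarM-central r x = commute-· λ w → transᵥ (scalarM-⊙ r (x ⊙ w))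
    (transᵥ (symᵥ (⊙-scaleV x r w)) (⊙-congˡ x (symᵥ (scalarM-⊙ r w))))

  module _ {n} (e e* : Fin n → ℤ) where
    open WithE e e*

    row-⊙ : ∀ {x} → (e*R ⊚ x) ≈ᵥ e*R → ∀ w → e*R ∙ (x ⊙ w) ≈ e*R ∙ w
    row-⊙ {x} e*x≈e* w = trans (sym (⊚-∙ e*R x w)) (∙-cong e*x≈e* (λ _ → refl))

    ⊙-row : ∀ {x} → (∀ w → e*R ∙ (x ⊙ w) ≈ e*R ∙ w) → (e*R ⊚ x) ≈ᵥ e*R
    ⊙-row {x} p = ∙-injective (λ w → trans (⊚-∙ e*R x w) (p w))

    InH-· : ∀ {x y} → InH x → InH y → InH (x · y)
    InH-· {x} {y} (x∈G , xe , e*x) (y∈G , ye , e*y) = InG-· x∈G y∈G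
      , transᵥ (·-⊙ x y eR) (transᵥ (⊙-congˡ x ye) xe)
      , ⊙-row (λ w → trans (∙-congˡ e*R (·-⊙ x y w)) (trans (row-⊙ e*x (y ⊙ w)) (row-⊙ e*y w)))

    -- An element of H fixes e and e*, so a left factor h is invisible both to the row e* x and to
    -- the preimage of e under x. These two facts eliminate the unknown h.
    module _ {x h g : Mat n} (h∈H : InH h) (x≈hg : x ≈ₘ (h · g)) where

      factor-row : ∀ w → e*R ∙ (x ⊙ w) ≈ e*R ∙ (g ⊙ w)
      factor-row w = trans (∙-congˡ e*R (transᵥ (⊙-congʳ x≈hg w) (·-⊙ h g w)))
        (row-⊙ (proj₂ (proj₂ h∈H)) (g ⊙ w))

      factor-column : ∀ {g⁻¹} → (g · g⁻¹) ≈ₘ idM → x ⊙ (g⁻¹ ⊙ eR) ≈ᵥ eR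
      factor-column {g⁻¹} gg⁻¹ = begin
        x ⊙ (g⁻¹ ⊙ eR)        ≈⟨ ⊙-congʳ x≈hg _ ⟩
        (h · g) ⊙ (g⁻¹ ⊙ eR)  ≈⟨ ·-⊙ h g _ ⟩
        h ⊙ (g ⊙ (g⁻¹ ⊙ eR))  ≈⟨ ⊙-congˡ h (inverse-⊙ gg⁻¹ eR) ⟩
        h ⊙ eR                ≈⟨ proj₁ (proj₂ h∈H) ⟩
        eR                    ∎
        where open ≈ᵥ-Reasoning

-- Matrices over R'' by components

module DualLinearAlgebra {c ℓ} (R : CommutativeRing c ℓ) where

  open CommutativeRing R using (rawRing; isCommutativeRing; _+_; _*_; -_; 0#; 1#)
  open LinearAlgebra rawRing (CommutativeRing._≈_ R) isCommutativeRing
  open MatrixOperations rawRing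
  open NaturalSolver commutativeSemiring using (solve; _:=_; _:+_; _:*_; con)
  open Dual2 rawRing using (R''; baseChange; incl)
  open DualNumbers R using (isCommutativeRing''; commutativeRing'')
  open D2
  open Lin rawRing using (InG; _≈ₘ_; module WithE)
  module M″ = MatrixOperations R''
  module L″ = LinearAlgebra R'' (RawRing._≈_ R'') isCommutativeRing''
  module S″ = Lin R''
  module G = LinearGroups R
  module G″ = LinearGroups commutativeRing''

  vec : ∀ {n} → (v₀ v₁ v₂ v₁₂ : Vect n) → M″.Vect n
  vec v₀ v₁ v₂ v₁₂ i = d2 (v₀ i) (v₁ i) (v₂ i) (v₁₂ i)

  mat : ∀ {n} → (x₀ x₁ x₂ x₁₂ : Mat n) → M″.Mat n
  mat x₀ x₁ x₂ x₁₂ i j = d2 (x₀ i j) (x₁ i j) (x₂ i j) (x₁₂ i j)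

  vec₀ : ∀ {n} → Vect n → M″.Vect n
  vec₀ v = vec v zeroV zeroV zeroV

  sumR-c0 : ∀ {n} (f : M″.Vect n) → c0 (M″.sumR f) ≡ sumR (λ i → c0 (f i))
  sumR-c0 {zero}  f = ≡.refl
  sumR-c0 {suc n} f = ≡.cong (λ r → c0 (f zero) + r) (sumR-c0 (λ i → f (suc i)))

  sumR-c1 : ∀ {n} (f : M″.Vect n) → c1 (M″.sumR f) ≡ sumR (λ i → c1 (f i))
  sumR-c1 {zero}  f = ≡.refl
  sumR-c1 {suc n} f = ≡.cong (λ r → c1 (f zero) + r) (sumR-c1 (λ i → f (suc i)))

  sumR-c2 : ∀ {n} (f : M″.Vect n) → c2 (M″.sumR f) ≡ sumR (λ i → c2 (f i))
  sumR-c2 {zero}  f = ≡.refl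
  sumR-c2 {suc n} f = ≡.cong (λ r → c2 (f zero) + r) (sumR-c2 (λ i → f (suc i)))

  sumR-c12 : ∀ {n} (f : M″.Vect n) → c12 (M″.sumR f) ≡ sumR (λ i → c12 (f i))
  sumR-c12 {zero}  f = ≡.refl
  sumR-c12 {suc n} f = ≡.cong (λ r → c12 (f zero) + r) (sumR-c12 (λ i → f (suc i)))

  ∙-vec : ∀ {n} (l₀ l₁ l₂ l₁₂ v₀ v₁ v₂ v₁₂ : Vect n) →
    vec l₀ l₁ l₂ l₁₂ M″.∙ vec v₀ v₁ v₂ v₁₂ L″.≈
    d2 (l₀ ∙ v₀) (l₀ ∙ v₁ + l₁ ∙ v₀) (l₀ ∙ v₂ + l₂ ∙ v₀)
      (l₀ ∙ v₁₂ + l₁ ∙ v₂ + l₂ ∙ v₁ + l₁₂ ∙ v₀)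
  ∙-vec {n} l₀ l₁ l₂ l₁₂ v₀ v₁ v₂ v₁₂ =
      reflexive (sumR-c0 {n} _)
    , trans (reflexive (sumR-c1 {n} _)) (sumR-+ {n} _ _)
    , trans (reflexive (sumR-c2 {n} _)) (sumR-+ {n} _ _)
    , trans (reflexive (sumR-c12 {n} _)) (trans (sumR-+ {n} _ _) (+-congʳ (trans (sumR-+ {n} _ _) (+-congʳ (sumR-+ {n} _ _)))))

  vec-cong : ∀ {n} {v₀ v₁ v₂ v₁₂ w₀ w₁ w₂ w₁₂ : Vect n} →
    v₀ ≈ᵥ w₀ → v₁ ≈ᵥ w₁ → v₂ ≈ᵥ w₂ → v₁₂ ≈ᵥ w₁₂ → vec v₀ v₁ v₂ v₁₂ L″.≈ᵥ vec w₀ w₁ w₂ w₁₂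
  vec-cong p q r s i = p i , q i , r i , s i

  mat-⊙ : ∀ {n} (x₀ x₁ x₂ x₁₂ : Mat n) (v₀ v₁ v₂ v₁₂ : Vect n) →
    mat x₀ x₁ x₂ x₁₂ M″.⊙ vec v₀ v₁ v₂ v₁₂ L″.≈ᵥ
    vec (x₀ ⊙ v₀) (addV (x₀ ⊙ v₁) (x₁ ⊙ v₀)) (addV (x₀ ⊙ v₂) (x₂ ⊙ v₀))
      (addV (addV (addV (x₀ ⊙ v₁₂) (x₁ ⊙ v₂)) (x₂ ⊙ v₁)) (x₁₂ ⊙ v₀))
  mat-⊙ x₀ x₁ x₂ x₁₂ v₀ v₁ v₂ v₁₂ i = ∙-vec (x₀ i) (x₁ i) (x₂ i) (x₁₂ i) v₀ v₁ v₂ v₁₂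

  0-∙ : ∀ {n} (v : Vect n) → zeroV ∙ v ≈ 0#
  0-∙ v = trans (∙-comm zeroV v) (∙-zeroV v)

  private
    x+0≈x : ∀ {x y} → y ≈ 0# → x + y ≈ x
    x+0≈x p = trans (+-congˡ p) (+-identityʳ _)

  vec₀-∙ : ∀ {n} (l v₀ v₁ v₂ v₁₂ : Vect n) →
    vec₀ l M″.∙ vec v₀ v₁ v₂ v₁₂ L″.≈ d2 (l ∙ v₀) (l ∙ v₁) (l ∙ v₂) (l ∙ v₁₂)
  vec₀-∙ l v₀ v₁ v₂ v₁₂ = L″.trans (∙-vec l zeroV zeroV zeroV v₀ v₁ v₂ v₁₂)
    ( refl , x+0≈x (0-∙ v₀) , x+0≈x (0-∙ v₀)
    , trans (x+0≈x (0-∙ v₀)) (trans (x+0≈x (0-∙ v₁)) (x+0≈x (0-∙ v₂))))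

  baseChange-⊙ : ∀ {n} (x : Mat n) (v₀ v₁ v₂ v₁₂ : Vect n) →
    baseChange x M″.⊙ vec v₀ v₁ v₂ v₁₂ L″.≈ᵥ vec (x ⊙ v₀) (x ⊙ v₁) (x ⊙ v₂) (x ⊙ v₁₂)
  baseChange-⊙ x v₀ v₁ v₂ v₁₂ i = vec₀-∙ (x i) v₀ v₁ v₂ v₁₂

  mat-⊙-vec₀ : ∀ {n} (x₀ x₁ x₂ x₁₂ : Mat n) (v : Vect n) →
    mat x₀ x₁ x₂ x₁₂ M″.⊙ vec₀ v L″.≈ᵥ vec (x₀ ⊙ v) (x₁ ⊙ v) (x₂ ⊙ v) (x₁₂ ⊙ v)
  mat-⊙-vec₀ x₀ x₁ x₂ x₁₂ v = L″.transᵥ (mat-⊙ x₀ x₁ x₂ x₁₂ v zeroV zeroV zeroV) λ i →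
      refl , 0+x≈x (∙-zeroV (x₀ i)) , 0+x≈x (∙-zeroV (x₀ i))
    , 0+x≈x (trans (+-cong (trans (+-cong (∙-zeroV (x₀ i)) (∙-zeroV (x₁ i))) (+-identityʳ 0#)) (∙-zeroV (x₂ i))) (+-identityʳ 0#))
    where
    0+x≈x : ∀ {x y} → y ≈ 0# → y + x ≈ x
    0+x≈x p = trans (+-congʳ p) (+-identityˡ _)

  baseChange-⊙-vec₀ : ∀ {n} (x : Mat n) (v : Vect n) → baseChange x M″.⊙ vec₀ v L″.≈ᵥ vec₀ (x ⊙ v)
  baseChange-⊙-vec₀ x v = L″.transᵥ (baseChange-⊙ x v zeroV zeroV zeroV)
    (vec-cong (λ _ → refl) (⊙-zeroV x) (⊙-zeroV x) (⊙-zeroV x))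

  -- As z has no ε-terms, commuting with it is a condition on each coefficient separately, and
  -- vectors without ε-terms are enough to read the coefficients off.
  commute-components : ∀ {n} (x₀ x₁ x₂ x₁₂ z : Mat n) →
    (∀ w → mat x₀ x₁ x₂ x₁₂ M″.⊙ (baseChange z M″.⊙ w) L″.≈ᵥ baseChange z M″.⊙ (mat x₀ x₁ x₂ x₁₂ M″.⊙ w)) →
    ∀ w → vec (x₀ ⊙ (z ⊙ w)) (x₁ ⊙ (z ⊙ w)) (x₂ ⊙ (z ⊙ w)) (x₁₂ ⊙ (z ⊙ w)) L″.≈ᵥ
      vec (z ⊙ (x₀ ⊙ w)) (z ⊙ (x₁ ⊙ w)) (z ⊙ (x₂ ⊙ w)) (z ⊙ (x₁₂ ⊙ w))
  commute-components x₀ x₁ x₂ x₁₂ z xz≈zx w = begin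
    vec (x₀ ⊙ (z ⊙ w)) (x₁ ⊙ (z ⊙ w)) (x₂ ⊙ (z ⊙ w)) (x₁₂ ⊙ (z ⊙ w)) ≈⟨ mat-⊙-vec₀ x₀ x₁ x₂ x₁₂ (z ⊙ w) ⟨
    x M″.⊙ vec₀ (z ⊙ w)                 ≈⟨ L″.⊙-congˡ x (baseChange-⊙-vec₀ z w) ⟨
    x M″.⊙ (baseChange z M″.⊙ vec₀ w)   ≈⟨ xz≈zx (vec₀ w) ⟩
    baseChange z M″.⊙ (x M″.⊙ vec₀ w)   ≈⟨ L″.⊙-congˡ (baseChange z) (mat-⊙-vec₀ x₀ x₁ x₂ x₁₂ w) ⟩
    baseChange z M″.⊙ vec (x₀ ⊙ w) (x₁ ⊙ w) (x₂ ⊙ w) (x₁₂ ⊙ w) ≈⟨ baseChange-⊙ z _ _ _ _ ⟩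
    vec (z ⊙ (x₀ ⊙ w)) (z ⊙ (x₁ ⊙ w)) (z ⊙ (x₂ ⊙ w)) (z ⊙ (x₁₂ ⊙ w)) ∎
    where
    open L″.≈ᵥ-Reasoning
    x = mat x₀ x₁ x₂ x₁₂

  natR-incl : ∀ k → S″.natR k L″.≈ incl (natR k)
  natR-incl zero    = refl , refl , refl , refl
  natR-incl (suc k) with natR-incl k
  ... | p , q , r , s = +-congˡ p , trans (+-identityˡ _) q , trans (+-identityˡ _) r , trans (+-identityˡ _) s

  -- The integral vectors e and e* are sent to R'' by arithmetic in R'' itself; this identifies the
  -- result with the base change of their images in R.
  intR-incl : ∀ k → S″.intR k L″.≈ incl (intR k)
  intR-incl (+ k)    = natR-incl k
  intR-incl -[1+ k ] with natR-incl (suc k)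
  ... | p , q , r , s = -‿cong p , trans (-‿cong q) -0#≈0# , trans (-‿cong r) -0#≈0# , trans (-‿cong s) -0#≈0#

  baseChange-inverse : ∀ {n} {x y : Mat n} → (x · y) ≈ₘ idM → (baseChange x M″.· baseChange y) S″.≈ₘ M″.idM
  baseChange-inverse {x = x} {y} xy≈1 = G″.⊙-inverse λ w → L″.transᵥ
    (L″.⊙-congˡ (baseChange x) (baseChange-⊙ y _ _ _ _)) (L″.transᵥ
      (baseChange-⊙ x _ _ _ _)
      (vec-cong (G.inverse-⊙ xy≈1 _) (G.inverse-⊙ xy≈1 _) (G.inverse-⊙ xy≈1 _) (G.inverse-⊙ xy≈1 _)))

  baseChange-InG : ∀ {n} {x : Mat n} → InG x → S″.InG (baseChange x)
  baseChange-InG (x⁻¹ , xx⁻¹ , x⁻¹x) = baseChange x⁻¹ , baseChange-inverse xx⁻¹ , baseChange-inverse x⁻¹x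

  baseChange-commute : ∀ {n} {x z : Mat n} → (∀ w → x ⊙ (z ⊙ w) ≈ᵥ z ⊙ (x ⊙ w)) →
    ∀ w → baseChange x M″.⊙ (baseChange z M″.⊙ w) L″.≈ᵥ baseChange z M″.⊙ (baseChange x M″.⊙ w)
  baseChange-commute {x = x} {z} p w = L″.transᵥ (two-step x z) (L″.transᵥ
    (vec-cong (p _) (p _) (p _) (p _)) (L″.symᵥ (two-step z x)))
    where
    two-step : ∀ x z → baseChange x M″.⊙ (baseChange z M″.⊙ w) L″.≈ᵥ _
    two-step x z = L″.transᵥ (L″.⊙-congˡ (baseChange x) (baseChange-⊙ z _ _ _ _)) (baseChange-⊙ x _ _ _ _)

  module _ {n} (e e* : Fin n → ℤ) where
    open WithE e e* using (eR; e*R; InH)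
    module W″ = Lin.WithE R'' e e*

    eR-vec₀ : W″.eR L″.≈ᵥ vec₀ eR
    eR-vec₀ i = intR-incl (e i)

    e*R-∙ : ∀ v₀ v₁ v₂ v₁₂ → W″.e*R M″.∙ vec v₀ v₁ v₂ v₁₂ L″.≈
      d2 (e*R ∙ v₀) (e*R ∙ v₁) (e*R ∙ v₂) (e*R ∙ v₁₂)
    e*R-∙ v₀ v₁ v₂ v₁₂ = L″.trans (L″.∙-cong (λ i → intR-incl (e* i)) (λ _ → L″.refl)) (vec₀-∙ e*R v₀ v₁ v₂ v₁₂)

    baseChange-InH : ∀ {x} → InH x → W″.InH (baseChange x)
    baseChange-InH {x} (x∈G , xe , e*x) = baseChange-InG x∈G
      , L″.transᵥ (L″.⊙-congˡ (baseChange x) eR-vec₀) (L″.transᵥ (baseChange-⊙ x _ _ _ _)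
          (L″.transᵥ (vec-cong xe (⊙-zeroV x) (⊙-zeroV x) (⊙-zeroV x)) (L″.symᵥ eR-vec₀)))
      , G″.⊙-row e e* (λ w → L″.trans (L″.∙-congˡ W″.e*R (baseChange-⊙ x _ _ _ _))
          (L″.trans (e*R-∙ _ _ _ _) (L″.trans
            (r _ , r _ , r _ , r _)
            (L″.sym (e*R-∙ _ _ _ _)))))
      where
      r : ∀ w → e*R ∙ (x ⊙ w) ≈ e*R ∙ w
      r = G.row-⊙ e e* e*x

    -- (1 + ε₁ u) (1 + ε₂ v)
    shear : Mat n → Mat n → M″.Mat n
    shear u v = mat idM u v (u · v)

    shear-⊙ : ∀ u v w₀ w₁ w₂ w₁₂ → shear u v M″.⊙ vec w₀ w₁ w₂ w₁₂ L″.≈ᵥ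
      vec w₀ (addV w₁ (u ⊙ w₀)) (addV w₂ (v ⊙ w₀))
        (addV (addV (addV w₁₂ (u ⊙ w₂)) (v ⊙ w₁)) (u ⊙ (v ⊙ w₀)))
    shear-⊙ u v w₀ w₁ w₂ w₁₂ = L″.transᵥ (mat-⊙ idM u v (u · v) w₀ w₁ w₂ w₁₂) λ i →
        ⊙-identity w₀ i
      , +-congʳ (⊙-identity w₁ i)
      , +-congʳ (⊙-identity w₂ i)
      , +-cong (+-congʳ (+-congʳ (⊙-identity w₁₂ i))) (·-⊙ u v w₀ i)

    -- The inverse of 1 + ε u is 1 - ε u, as the square of ε vanishes. The negatives are arguments,
    -- so that exchanging their roles gives the inverse on the other side as well.
    shear-inverse : ∀ {u v u⁻ v⁻} →
      (∀ w → addV (u⁻ ⊙ w) (u ⊙ w) ≈ᵥ zeroV) → (∀ w → addV (v⁻ ⊙ w) (v ⊙ w) ≈ᵥ zeroV) →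
      (∀ w → u ⊙ (v ⊙ w) ≈ᵥ v ⊙ (u ⊙ w)) →
      ∀ w → shear u v M″.⊙ (shear u⁻ v⁻ M″.⊙ w) L″.≈ᵥ w
    shear-inverse {u} {v} {u⁻} {v⁻} u⁻+u v⁻+v uv≈vu w = L″.transᵥ
      (L″.⊙-congˡ (shear u v) (shear-⊙ u⁻ v⁻ _ _ _ _)) (L″.transᵥ
        (shear-⊙ u v _ _ _ _)
        (vec-cong (λ _ → refl) (λ i → first (u⁻+u w₀ i)) (λ i → first (v⁻+v w₀ i)) second))
      where
      w₀ w₁ w₂ w₁₂ : Vect n
      w₀ i = c0 (w i)
      w₁ i = c1 (w i)
      w₂ i = c2 (w i)
      w₁₂ i = c12 (w i)
      first : ∀ {x y z} → y + z ≈ 0# → x + y + z ≈ x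
      first p = trans (+-assoc _ _ _) (x+0≈x p)
      second : ∀ i → _
      second i = begin
        w₁₂ i + (u⁻ ⊙ w₂) i + (v⁻ ⊙ w₁) i + (u⁻ ⊙ (v⁻ ⊙ w₀)) i
          + (u ⊙ addV w₂ (v⁻ ⊙ w₀)) i + (v ⊙ addV w₁ (u⁻ ⊙ w₀)) i + (u ⊙ (v ⊙ w₀)) i
          -- Replacing u v by v u on w₀ lets it cancel against v u⁻; the remaining terms then pair
          -- off under u⁻ + u or v⁻ + v.
          ≈⟨ +-cong (+-cong (+-congˡ (⊙-addV u w₂ (v⁻ ⊙ w₀) i)) (⊙-addV v w₁ (u⁻ ⊙ w₀) i)) (uv≈vu w₀ i) ⟩
        w₁₂ i + (u⁻ ⊙ w₂) i + (v⁻ ⊙ w₁) i + (u⁻ ⊙ (v⁻ ⊙ w₀)) i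
          + ((u ⊙ w₂) i + (u ⊙ (v⁻ ⊙ w₀)) i) + ((v ⊙ w₁) i + (v ⊙ (u⁻ ⊙ w₀)) i) + (v ⊙ (u ⊙ w₀)) i
          ≈⟨ solve 9 (λ a b c d b′ d′ c′ f f′ →
               a :+ b :+ c :+ d :+ (b′ :+ d′) :+ (c′ :+ f) :+ f′ :=
               a :+ (b :+ b′) :+ (c :+ c′) :+ (d :+ d′) :+ (f :+ f′)) refl _ _ _ _ _ _ _ _ _ ⟩
        w₁₂ i + ((u⁻ ⊙ w₂) i + (u ⊙ w₂) i) + ((v⁻ ⊙ w₁) i + (v ⊙ w₁) i)
          + ((u⁻ ⊙ (v⁻ ⊙ w₀)) i + (u ⊙ (v⁻ ⊙ w₀)) i) + ((v ⊙ (u⁻ ⊙ w₀)) i + (v ⊙ (u ⊙ w₀)) i)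
          ≈⟨ x+0≈x (trans (sym (⊙-addV v (u⁻ ⊙ w₀) (u ⊙ w₀) i)) (trans (⊙-congˡ v (u⁻+u w₀) i) (⊙-zeroV v i))) ⟩
        w₁₂ i + ((u⁻ ⊙ w₂) i + (u ⊙ w₂) i) + ((v⁻ ⊙ w₁) i + (v ⊙ w₁) i)
          + ((u⁻ ⊙ (v⁻ ⊙ w₀)) i + (u ⊙ (v⁻ ⊙ w₀)) i)
          ≈⟨ trans (x+0≈x (u⁻+u (v⁻ ⊙ w₀) i)) (trans (x+0≈x (v⁻+v w₁ i)) (x+0≈x (u⁻+u w₂ i))) ⟩
        w₁₂ i ∎
        where open ≈-Reasoning

    neg : Mat n → Mat n
    neg x i j = - x i j

    neg-inverseˡ : ∀ x w → addV (neg x ⊙ w) (x ⊙ w) ≈ᵥ zeroV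
    neg-inverseˡ x w i = trans (sym (sumR-+ {n} _ _)) (sumR-zero λ k →
      trans (sym (distribʳ (w k) (- x i k) (x i k))) (trans (*-congʳ (-‿inverseˡ (x i k))) (zeroˡ (w k))))

    module _ {u v : Mat n} (uv≈vu : ∀ w → u ⊙ (v ⊙ w) ≈ᵥ v ⊙ (u ⊙ w)) where

      private
        neg-comm : ∀ w → neg u ⊙ (neg v ⊙ w) ≈ᵥ neg v ⊙ (neg u ⊙ w)
        neg-comm w i = begin
          (neg u ⊙ (neg v ⊙ w)) i  ≈⟨ neg-neg u v i ⟩
          (u ⊙ (v ⊙ w)) i          ≈⟨ uv≈vu w i ⟩
          (v ⊙ (u ⊙ w)) i          ≈⟨ neg-neg v u i ⟨
          (neg v ⊙ (neg u ⊙ w)) i  ∎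
          where
          open ≈-Reasoning
          neg-neg : ∀ x y → neg x ⊙ (neg y ⊙ w) ≈ᵥ x ⊙ (y ⊙ w)
          neg-neg x y i = +-cancelʳ ((x ⊙ (neg y ⊙ w)) i) _ _ (begin
            (neg x ⊙ (neg y ⊙ w)) i + (x ⊙ (neg y ⊙ w)) i ≈⟨ neg-inverseˡ x (neg y ⊙ w) i ⟩
            0#                                            ≈⟨ ⊙-zeroV x i ⟨
            (x ⊙ zeroV) i                                 ≈⟨ ⊙-congˡ x (neg-inverseˡ y w) i ⟨
            (x ⊙ addV (neg y ⊙ w) (y ⊙ w)) i              ≈⟨ ⊙-addV x (neg y ⊙ w) (y ⊙ w) i ⟩
            (x ⊙ (neg y ⊙ w)) i + (x ⊙ (y ⊙ w)) i         ≈⟨ +-comm _ _ ⟩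
            (x ⊙ (y ⊙ w)) i + (x ⊙ (neg y ⊙ w)) i         ∎)

      shear-InG : S″.InG (shear u v)
      shear-InG = shear (neg u) (neg v)
        , G″.⊙-inverse (shear-inverse {u} {v} (neg-inverseˡ u) (neg-inverseˡ v) uv≈vu)
        , G″.⊙-inverse (shear-inverse {neg u} {neg v}
            (λ w i → trans (+-comm _ _) (neg-inverseˡ u w i))
            (λ w i → trans (+-comm _ _) (neg-inverseˡ v w i)) neg-comm)

      shear-InH : (u ⊙ eR) ≈ᵥ zeroV → (v ⊙ eR) ≈ᵥ zeroV →
        (∀ w → e*R ∙ (u ⊙ w) ≈ 0#) → (∀ w → e*R ∙ (v ⊙ w) ≈ 0#) → W″.InH (shear u v)
      shear-InH ue ve e*u e*v = shear-InG
        , L″.transᵥ (L″.⊙-congˡ (shear u v) eR-vec₀) (L″.transᵥ (mat-⊙-vec₀ idM u v (u · v) eR)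
            (L″.transᵥ (vec-cong (⊙-identity eR) ue ve
              (transᵥ (·-⊙ u v eR) (transᵥ (⊙-congˡ u ve) (⊙-zeroV u)))) (L″.symᵥ eR-vec₀)))
        , G″.⊙-row e e* (λ w → L″.trans (L″.∙-congˡ W″.e*R (shear-⊙ u v _ _ _ _))
            (L″.trans (e*R-∙ _ _ _ _) (L″.trans
              ( refl , drop (e*u _) , drop (e*v _)
              , trans (drop (e*u _)) (trans (drop (e*v _)) (drop (e*u _))))
              (L″.sym (e*R-∙ _ _ _ _)))))
        where
        drop : ∀ {x y : Vect n} → e*R ∙ y ≈ 0# → e*R ∙ addV x y ≈ e*R ∙ x
        drop {x} {y} p = trans (∙-addV e*R x y) (x+0≈x p)

      shear-commute : ∀ {z} → (∀ w → u ⊙ (z ⊙ w) ≈ᵥ z ⊙ (u ⊙ w)) → (∀ w → v ⊙ (z ⊙ w) ≈ᵥ z ⊙ (v ⊙ w)) →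
        ∀ w → shear u v M″.⊙ (baseChange z M″.⊙ w) L″.≈ᵥ baseChange z M″.⊙ (shear u v M″.⊙ w)
      shear-commute {z} uz vz w = L″.transᵥ
        (L″.transᵥ (L″.⊙-congˡ (shear u v) (baseChange-⊙ z w₀ w₁ w₂ w₁₂)) (shear-⊙ u v _ _ _ _))
        (L″.transᵥ (vec-cong (λ _ → refl) (split uz) (split vz) third)
        (L″.symᵥ (L″.transᵥ (L″.⊙-congˡ (baseChange z) (shear-⊙ u v w₀ w₁ w₂ w₁₂)) (baseChange-⊙ z _ _ _ _))))
        where
        w₀ w₁ w₂ w₁₂ : Vect n
        w₀ i = c0 (w i)
        w₁ i = c1 (w i)
        w₂ i = c2 (w i)
        w₁₂ i = c12 (w i)
        split : ∀ {x x′} {a : Mat n} → (∀ w → a ⊙ (z ⊙ w) ≈ᵥ z ⊙ (a ⊙ w)) →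
          addV (z ⊙ x) (a ⊙ (z ⊙ x′)) ≈ᵥ z ⊙ addV x (a ⊙ x′)
        split {x} {x′} {a} az = transᵥ (addV-cong (λ _ → refl) (az x′)) (symᵥ (⊙-addV z x (a ⊙ x′)))
        third : addV (addV (addV (z ⊙ w₁₂) (u ⊙ (z ⊙ w₂))) (v ⊙ (z ⊙ w₁))) (u ⊙ (v ⊙ (z ⊙ w₀)))
          ≈ᵥ z ⊙ addV (addV (addV w₁₂ (u ⊙ w₂)) (v ⊙ w₁)) (u ⊙ (v ⊙ w₀))
        third = begin
          addV (addV (addV (z ⊙ w₁₂) (u ⊙ (z ⊙ w₂))) (v ⊙ (z ⊙ w₁))) (u ⊙ (v ⊙ (z ⊙ w₀)))
            ≈⟨ addV-cong (addV-cong (split uz) (vz w₁)) (transᵥ (⊙-congˡ u (vz w₀)) (uz (v ⊙ w₀))) ⟩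
          addV (addV (z ⊙ addV w₁₂ (u ⊙ w₂)) (z ⊙ (v ⊙ w₁))) (z ⊙ (u ⊙ (v ⊙ w₀)))
            ≈⟨ addV-cong (symᵥ (⊙-addV z _ _)) (λ _ → refl) ⟩
          addV (z ⊙ addV (addV w₁₂ (u ⊙ w₂)) (v ⊙ w₁)) (z ⊙ (u ⊙ (v ⊙ w₀)))
            ≈⟨ ⊙-addV z _ _ ⟨
          z ⊙ addV (addV (addV w₁₂ (u ⊙ w₂)) (v ⊙ w₁)) (u ⊙ (v ⊙ w₀)) ∎
          where open ≈ᵥ-Reasoning

-- Expansion of a deformation to second order

module Deformations {c ℓ} (R : CommutativeRing c ℓ)
  {n} (e e* : Fin n → ℤ) (τ a y : Lin.Mat (CommutativeRing.rawRing R) n) where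

  open CommutativeRing R using (rawRing; isCommutativeRing; _+_; _*_; -_; 0#; 1#)
  open LinearAlgebra rawRing (CommutativeRing._≈_ R) isCommutativeRing
  open MatrixOperations rawRing hiding (module Corner)
  open NaturalSolver commutativeSemiring using (solve; _:=_; _:+_; _:*_)
  open Tangential R
  open Lin rawRing using (InG; InGcent; _≈ₘ_)
  -- The versions from `Corner` unfold to the same matrices, so hypotheses phrased with `WithE`
  -- apply to them directly.
  open Lin.WithE rawRing e e* hiding (1H; τH)
  open MatrixOperations.Corner rawRing eR e*R τ
  open Cyclicity rawRing (CommutativeRing._≈_ R) isCommutativeRing τ
  open CornerProperties rawRing (CommutativeRing._≈_ R) isCommutativeRing eR e*R τ
  open Rigidity rawRing (CommutativeRing._≈_ R) isCommutativeRing eR e*R τ using (Intertwined)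
  open DualLinearAlgebra R
  open D2

  cancel-0 : ∀ {x y z} → x + y ≈ 0# → x + z ≈ 0# → y ≈ z
  cancel-0 {x} p q = +-cancelˡ x _ _ (trans p (sym q))

  -- p, q and r arise by multiplying f with the coefficients of ε₁, ε₂ and
  -- ε₁ε₂ of the G_τ(R'')-factor of a y (1 + ε₁ u) (1 + ε₂ v).
  record Lifting (f g u v : Mat n) : Set (c ⊔ ℓ) where
    field
      p q r      : Mat n
      p-central  : Central p
      q-central  : Central q
      r-central  : Central r
      u-column   : u ⊙ (f ⊙ eR) ≈ᵥ p ⊙ (f ⊙ eR)
      v-column   : v ⊙ (f ⊙ eR) ≈ᵥ q ⊙ (f ⊙ eR)
      u-row      : ∀ w → e*R ∙ (g ⊙ (u ⊙ w)) ≈ e*R ∙ (g ⊙ (p ⊙ w))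
      uv-row     : ∀ w → e*R ∙ (g ⊙ (u ⊙ (v ⊙ w))) ≈ e*R ∙ (g ⊙ (r ⊙ w))
      uv-column  : addV (v ⊙ (u ⊙ (f ⊙ eR))) (r ⊙ (f ⊙ eR)) ≈ᵥ
        addV (p ⊙ (q ⊙ (f ⊙ eR))) (q ⊙ (p ⊙ (f ⊙ eR)))

  module _ (a∈G : InG a) (y∈H : InHcent τH y) (tangential : DoublyTangential e e* τ a y)
    {h f g : Mat n} (h∈H : InH h) (ay≈hg : (a · y) ≈ₘ (h · g)) (gf≈1 : (g · f) ≈ₘ idM) where

    private
      a⁻¹ y⁻¹ : Mat n
      a⁻¹ = proj₁ a∈G
      y⁻¹ = proj₁ (proj₁ (proj₁ y∈H))

      ay-injective : ∀ {v w} → a ⊙ (y ⊙ v) ≈ᵥ a ⊙ (y ⊙ w) → v ≈ᵥ w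
      ay-injective {v} {w} p = transᵥ (symᵥ (undo v)) (transᵥ (⊙-congˡ y⁻¹ (⊙-congˡ a⁻¹ p)) (undo w))
        where
        undo : ∀ v → y⁻¹ ⊙ (a⁻¹ ⊙ (a ⊙ (y ⊙ v))) ≈ᵥ v
        undo v = transᵥ (⊙-congˡ y⁻¹ (G.inverse-⊙ (proj₂ (proj₂ a∈G)) (y ⊙ v)))
          (G.inverse-⊙ (proj₂ (proj₂ (proj₁ (proj₁ y∈H)))) v)

      ay-zero : ∀ {v} → a ⊙ (y ⊙ v) ≈ᵥ zeroV → v ≈ᵥ zeroV
      ay-zero p = ay-injective (transᵥ p (symᵥ (transᵥ (⊙-congˡ a (⊙-zeroV y)) (⊙-zeroV a))))

      ayfe : a ⊙ (y ⊙ (f ⊙ eR)) ≈ᵥ eR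
      ayfe = transᵥ (symᵥ (·-⊙ a y (f ⊙ eR))) (G.factor-column e e* h∈H ay≈hg gf≈1)

      ay-row : ∀ w → e*R ∙ (a ⊙ (y ⊙ w)) ≈ e*R ∙ (g ⊙ w)
      ay-row w = trans (∙-congˡ e*R (symᵥ (·-⊙ a y w))) (G.factor-row e e* h∈H ay≈hg w)

    module _ {u v : Mat n} (uv≈vu : ∀ w → u ⊙ (v ⊙ w) ≈ᵥ v ⊙ (u ⊙ w))
      (ue : (u ⊙ eR) ≈ᵥ zeroV) (ve : (v ⊙ eR) ≈ᵥ zeroV)
      (e*u : ∀ w → e*R ∙ (u ⊙ w) ≈ 0#) (e*v : ∀ w → e*R ∙ (v ⊙ w) ≈ 0#)
      (uτH : ∀ w → u ⊙ (τH ⊙ w) ≈ᵥ τH ⊙ (u ⊙ w)) (vτH : ∀ w → v ⊙ (τH ⊙ w) ≈ᵥ τH ⊙ (v ⊙ w)) where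

      private
        s y″ : M″.Mat n
        s  = shear e e* u v
        y″ = baseChange y M″.· s

        y″-commute : ∀ w → y″ M″.⊙ (baseChange τH M″.⊙ w) L″.≈ᵥ baseChange τH M″.⊙ (y″ M″.⊙ w)
        y″-commute w = begin
          y″ M″.⊙ (baseChange τH M″.⊙ w)
            ≈⟨ L″.·-⊙ (baseChange y) s (baseChange τH M″.⊙ w) ⟩
          baseChange y M″.⊙ (s M″.⊙ (baseChange τH M″.⊙ w))
            ≈⟨ L″.⊙-congˡ (baseChange y) (shear-commute e e* uv≈vu uτH vτH w) ⟩
          baseChange y M″.⊙ (baseChange τH M″.⊙ (s M″.⊙ w))
            ≈⟨ baseChange-commute (G.·-commute (proj₂ y∈H)) (s M″.⊙ w) ⟩
          baseChange τH M″.⊙ (baseChange y M″.⊙ (s M″.⊙ w))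
            ≈⟨ L″.⊙-congˡ (baseChange τH) (L″.·-⊙ (baseChange y) s w) ⟨
          baseChange τH M″.⊙ (y″ M″.⊙ w) ∎
          where open L″.≈ᵥ-Reasoning

        y″∈X : L''.WithE.InX' e e* (baseChange τ) (baseChange τH) (baseChange a) y″
        y″∈X = tangential y″
          ( G″.InH-· e e* (baseChange-InH e e* (proj₁ y∈H)) (shear-InH e e* uv≈vu ue ve e*u e*v)
          , G″.commute-· y″-commute )
          -- The constant term of `shear` is the identity, so y″ reduces to y.
          (λ i j → trans (reflexive (sumR-c0 {n} _)) (⊚-identity (y i) j))

        h″ g″ f″ : M″.Mat n
        h″ = proj₁ (proj₂ y″∈X)
        g″ = proj₁ (proj₂ (proj₂ y″∈X))

        h″∈H : L''.WithE.InH e e* h″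
        h″∈H = proj₁ (proj₂ (proj₂ (proj₂ y″∈X)))

        g″∈Gτ : L''.InGcent (baseChange τ) g″
        g″∈Gτ = proj₁ (proj₂ (proj₂ (proj₂ (proj₂ y″∈X))))

        ay″≈h″g″ : (baseChange a M″.· y″) S″.≈ₘ (h″ M″.· g″)
        ay″≈h″g″ = proj₂ (proj₂ (proj₂ (proj₂ (proj₂ y″∈X))))

        f″ = proj₁ (proj₁ g″∈Gτ)

        g″f″≈1 : (g″ M″.· f″) S″.≈ₘ M″.idM
        g″f″≈1 = proj₁ (proj₂ (proj₁ g″∈Gτ))

        f″g″≈1 : (f″ M″.· g″) S″.≈ₘ M″.idM
        f″g″≈1 = proj₂ (proj₂ (proj₁ g″∈Gτ))

        g₀ g₁ g₂ g₁₂ f₀ f₁ f₂ f₁₂ : Mat n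
        g₀ i j = c0 (g″ i j)
        g₁ i j = c1 (g″ i j)
        g₂ i j = c2 (g″ i j)
        g₁₂ i j = c12 (g″ i j)
        f₀ i j = c0 (f″ i j)
        f₁ i j = c1 (f″ i j)
        f₂ i j = c2 (f″ i j)
        f₁₂ i j = c12 (f″ i j)

        g-commute : ∀ w → vec (g₀ ⊙ (τ ⊙ w)) (g₁ ⊙ (τ ⊙ w)) (g₂ ⊙ (τ ⊙ w)) (g₁₂ ⊙ (τ ⊙ w)) L″.≈ᵥ
          vec (τ ⊙ (g₀ ⊙ w)) (τ ⊙ (g₁ ⊙ w)) (τ ⊙ (g₂ ⊙ w)) (τ ⊙ (g₁₂ ⊙ w))
        g-commute = commute-components g₀ g₁ g₂ g₁₂ τ (G″.·-commute (proj₂ g″∈Gτ))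

        f₀-central : Central f₀
        f₀-central w i = proj₁ (commute-components f₀ f₁ f₂ f₁₂ τ
          (G″.inverse-commute g″f″≈1 f″g″≈1 (proj₂ g″∈Gτ)) w i)

        -- The four coefficients of g″ f″ = 1; those beyond the constant one express f₁, f₂ and f₁₂
        -- on e through g″.
        gf : ∀ w → vec (g₀ ⊙ (f₀ ⊙ w)) (addV (g₀ ⊙ (f₁ ⊙ w)) (g₁ ⊙ (f₀ ⊙ w)))
          (addV (g₀ ⊙ (f₂ ⊙ w)) (g₂ ⊙ (f₀ ⊙ w)))
          (addV (addV (addV (g₀ ⊙ (f₁₂ ⊙ w)) (g₁ ⊙ (f₂ ⊙ w))) (g₂ ⊙ (f₁ ⊙ w))) (g₁₂ ⊙ (f₀ ⊙ w))) L″.≈ᵥ vec₀ w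
        gf w = L″.transᵥ (L″.symᵥ (L″.transᵥ (L″.⊙-congˡ g″ (mat-⊙-vec₀ f₀ f₁ f₂ f₁₂ w))
          (mat-⊙ g₀ g₁ g₂ g₁₂ _ _ _ _))) (G″.inverse-⊙ g″f″≈1 (vec₀ w))

        f₀g₀ : ∀ w → f₀ ⊙ (g₀ ⊙ w) ≈ᵥ w
        f₀g₀ w i = proj₁ (L″.transᵥ (L″.symᵥ (L″.transᵥ (L″.⊙-congˡ f″ (mat-⊙-vec₀ g₀ g₁ g₂ g₁₂ w))
          (mat-⊙ f₀ f₁ f₂ f₁₂ _ _ _ _))) (G″.inverse-⊙ f″g″≈1 (vec₀ w)) i)

        ay″-⊙ : ∀ w → (baseChange a M″.· y″) M″.⊙ w L″.≈ᵥ baseChange a M″.⊙ (baseChange y M″.⊙ (s M″.⊙ w))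
        ay″-⊙ w = L″.transᵥ (L″.·-⊙ (baseChange a) y″ w) (L″.⊙-congˡ (baseChange a) (L″.·-⊙ (baseChange y) s w))

        baseChange² : ∀ v₀ v₁ v₂ v₁₂ → baseChange a M″.⊙ (baseChange y M″.⊙ vec v₀ v₁ v₂ v₁₂) L″.≈ᵥ
          vec (a ⊙ (y ⊙ v₀)) (a ⊙ (y ⊙ v₁)) (a ⊙ (y ⊙ v₂)) (a ⊙ (y ⊙ v₁₂))
        baseChange² v₀ v₁ v₂ v₁₂ = L″.transᵥ (L″.⊙-congˡ (baseChange a) (baseChange-⊙ y v₀ v₁ v₂ v₁₂))
          (baseChange-⊙ a _ _ _ _)

        rows : ∀ w → d2 (e*R ∙ (a ⊙ (y ⊙ (idM ⊙ w)))) (e*R ∙ (a ⊙ (y ⊙ (u ⊙ w))))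
            (e*R ∙ (a ⊙ (y ⊙ (v ⊙ w)))) (e*R ∙ (a ⊙ (y ⊙ ((u · v) ⊙ w)))) L″.≈
          d2 (e*R ∙ (g₀ ⊙ w)) (e*R ∙ (g₁ ⊙ w)) (e*R ∙ (g₂ ⊙ w)) (e*R ∙ (g₁₂ ⊙ w))
        rows w = L″.trans (L″.sym (e*R-∙ e e* _ _ _ _)) (L″.trans
          (L″.∙-congˡ (W″.e*R e e*) (L″.symᵥ (L″.transᵥ (ay″-⊙ (vec₀ w)) (L″.transᵥ
            (L″.⊙-congˡ (baseChange a) (L″.⊙-congˡ (baseChange y) (mat-⊙-vec₀ idM u v (u · v) w)))
            (baseChange² _ _ _ _)))))
          (L″.trans (G″.factor-row e e* h″∈H ay″≈h″g″ (vec₀ w)) (L″.trans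
            (L″.∙-congˡ (W″.e*R e e*) (mat-⊙-vec₀ g₀ g₁ g₂ g₁₂ w)) (e*R-∙ e e* _ _ _ _))))

        F₀ F₁ F₂ F₁₂ : Vect n
        F₀ = f₀ ⊙ eR
        F₁ = f₁ ⊙ eR
        F₂ = f₂ ⊙ eR
        F₁₂ = f₁₂ ⊙ eR

        -- The preimage of e under a y″ is f″ e; this is the expansion of a y″ f″ e = e into
        -- coefficients, with the shear applied to f″ e.
        columns : vec (a ⊙ (y ⊙ F₀)) (a ⊙ (y ⊙ addV F₁ (u ⊙ F₀))) (a ⊙ (y ⊙ addV F₂ (v ⊙ F₀)))
          (a ⊙ (y ⊙ addV (addV (addV F₁₂ (u ⊙ F₂)) (v ⊙ F₁)) (u ⊙ (v ⊙ F₀)))) L″.≈ᵥ vec₀ eR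
        columns = begin
          _ ≈⟨ baseChange² _ _ _ _ ⟨
          baseChange a M″.⊙ (baseChange y M″.⊙ vec _ _ _ _)
            ≈⟨ L″.⊙-congˡ (baseChange a) (L″.⊙-congˡ (baseChange y) (shear-⊙ e e* u v F₀ F₁ F₂ F₁₂)) ⟨
          baseChange a M″.⊙ (baseChange y M″.⊙ (s M″.⊙ vec F₀ F₁ F₂ F₁₂))
            ≈⟨ ay″-⊙ _ ⟨
          (baseChange a M″.· y″) M″.⊙ vec F₀ F₁ F₂ F₁₂
            ≈⟨ L″.⊙-congˡ (baseChange a M″.· y″) (mat-⊙-vec₀ f₀ f₁ f₂ f₁₂ eR) ⟨
          (baseChange a M″.· y″) M″.⊙ (f″ M″.⊙ vec₀ eR)
            ≈⟨ L″.⊙-congˡ (baseChange a M″.· y″) (L″.⊙-congˡ f″ (eR-vec₀ e e*)) ⟨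
          (baseChange a M″.· y″) M″.⊙ (f″ M″.⊙ W″.eR e e*)
            ≈⟨ G″.factor-column e e* h″∈H ay″≈h″g″ g″f″≈1 ⟩
          W″.eR e e*
            ≈⟨ eR-vec₀ e e* ⟩
          vec₀ eR ∎
          where open L″.≈ᵥ-Reasoning

        -- The factorisation over R'' need not extend the one given over R, but in both the column
        -- is the preimage of e under a y. `g₀-row` is the analogue for rows.
        F₀≈fe : F₀ ≈ᵥ f ⊙ eR
        F₀≈fe = ay-injective (transᵥ (λ i → proj₁ (columns i)) (symᵥ ayfe))

        E₁ : addV F₁ (u ⊙ F₀) ≈ᵥ zeroV
        E₁ = ay-zero (λ i → proj₁ (proj₂ (columns i)))

        E₂ : addV F₂ (v ⊙ F₀) ≈ᵥ zeroV
        E₂ = ay-zero (λ i → proj₁ (proj₂ (proj₂ (columns i))))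

        E₁₂ : addV (addV (addV F₁₂ (u ⊙ F₂)) (v ⊙ F₁)) (u ⊙ (v ⊙ F₀)) ≈ᵥ zeroV
        E₁₂ = ay-zero (λ i → proj₂ (proj₂ (proj₂ (columns i))))

        g₀-row : ∀ w → e*R ∙ (g₀ ⊙ w) ≈ e*R ∙ (g ⊙ w)
        g₀-row w = begin
          e*R ∙ (g₀ ⊙ w)               ≈⟨ proj₁ (rows w) ⟨
          e*R ∙ (a ⊙ (y ⊙ (idM ⊙ w)))  ≈⟨ ∙-congˡ e*R (⊙-congˡ a (⊙-congˡ y (⊙-identity w))) ⟩
          e*R ∙ (a ⊙ (y ⊙ w))          ≈⟨ ay-row w ⟩
          e*R ∙ (g ⊙ w)                ∎
          where open ≈-Reasoning

        -- Since g₀ f₀ = 1 and e* g₀ = e* g, the row e* x equals e* g f₀ x. This is why the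
        -- coefficients of g″ are multiplied by f₀.
        row-via : ∀ x w w′ → e*R ∙ (a ⊙ (y ⊙ w′)) ≈ e*R ∙ (x ⊙ w) →
          e*R ∙ (g ⊙ w′) ≈ e*R ∙ (g ⊙ ((f₀ · x) ⊙ w))
        row-via x w w′ eq = begin
          e*R ∙ (g ⊙ w′)                ≈⟨ ay-row w′ ⟨
          e*R ∙ (a ⊙ (y ⊙ w′))          ≈⟨ eq ⟩
          e*R ∙ (x ⊙ w)                 ≈⟨ ∙-congˡ e*R (λ i → proj₁ (gf (x ⊙ w) i)) ⟨
          e*R ∙ (g₀ ⊙ (f₀ ⊙ (x ⊙ w)))   ≈⟨ g₀-row _ ⟩
          e*R ∙ (g ⊙ (f₀ ⊙ (x ⊙ w)))    ≈⟨ ∙-congˡ e*R (⊙-congˡ g (·-⊙ f₀ x w)) ⟨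
          e*R ∙ (g ⊙ ((f₀ · x) ⊙ w))    ∎
          where open ≈-Reasoning

        f₀-cancel : ∀ {v w} → addV (g₀ ⊙ v) w ≈ᵥ zeroV → addV v (f₀ ⊙ w) ≈ᵥ zeroV
        f₀-cancel {v} {w} p = begin
          addV v (f₀ ⊙ w)                 ≈⟨ addV-cong (f₀g₀ v) (λ _ → refl) ⟨
          addV (f₀ ⊙ (g₀ ⊙ v)) (f₀ ⊙ w)   ≈⟨ ⊙-addV f₀ (g₀ ⊙ v) w ⟨
          f₀ ⊙ addV (g₀ ⊙ v) w            ≈⟨ ⊙-congˡ f₀ p ⟩
          f₀ ⊙ zeroV                      ≈⟨ ⊙-zeroV f₀ ⟩
          zeroV                           ∎
          where open ≈ᵥ-Reasoning

        p q r : Mat n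
        p = f₀ · g₁
        q = f₀ · g₂
        r = f₀ · g₁₂

        F₁+pF₀ : addV F₁ (p ⊙ F₀) ≈ᵥ zeroV
        F₁+pF₀ = transᵥ (addV-cong (λ _ → refl) (·-⊙ f₀ g₁ F₀)) (f₀-cancel (λ i → proj₁ (proj₂ (gf eR i))))

        F₂+qF₀ : addV F₂ (q ⊙ F₀) ≈ᵥ zeroV
        F₂+qF₀ = transᵥ (addV-cong (λ _ → refl) (·-⊙ f₀ g₂ F₀)) (f₀-cancel (λ i → proj₁ (proj₂ (proj₂ (gf eR i)))))

        F₁₂+pF₂+qF₁+rF₀ : addV (addV (addV F₁₂ (p ⊙ F₂)) (q ⊙ F₁)) (r ⊙ F₀) ≈ᵥ zeroV
        F₁₂+pF₂+qF₁+rF₀ i = begin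
          F₁₂ i + (p ⊙ F₂) i + (q ⊙ F₁) i + (r ⊙ F₀) i
            ≈⟨ +-cong (+-cong (+-congˡ (·-⊙ f₀ g₁ F₂ i)) (·-⊙ f₀ g₂ F₁ i)) (·-⊙ f₀ g₁₂ F₀ i) ⟩
          F₁₂ i + (f₀ ⊙ (g₁ ⊙ F₂)) i + (f₀ ⊙ (g₂ ⊙ F₁)) i + (f₀ ⊙ (g₁₂ ⊙ F₀)) i
            ≈⟨ solve 4 (λ a b c d → a :+ b :+ c :+ d := a :+ (b :+ c :+ d)) refl _ _ _ _ ⟩
          F₁₂ i + ((f₀ ⊙ (g₁ ⊙ F₂)) i + (f₀ ⊙ (g₂ ⊙ F₁)) i + (f₀ ⊙ (g₁₂ ⊙ F₀)) i)
            ≈⟨ +-congˡ (trans (⊙-addV f₀ _ _ i) (+-congʳ (⊙-addV f₀ _ _ i))) ⟨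
          F₁₂ i + (f₀ ⊙ addV (addV (g₁ ⊙ F₂) (g₂ ⊙ F₁)) (g₁₂ ⊙ F₀)) i
            ≈⟨ f₀-cancel (λ i → trans (solve 4 (λ a b c d → a :+ (b :+ c :+ d) := a :+ b :+ c :+ d) refl _ _ _ _)
                 (proj₂ (proj₂ (proj₂ (gf eR i))))) i ⟩
          0# ∎
          where open ≈-Reasoning

        ⊙-zero-sum : ∀ (x : Mat n) {v w} → addV v w ≈ᵥ zeroV → addV (x ⊙ v) (x ⊙ w) ≈ᵥ zeroV
        ⊙-zero-sum x {v} {w} v+w = transᵥ (symᵥ (⊙-addV x v w)) (transᵥ (⊙-congˡ x v+w) (⊙-zeroV x))

        -- By `E₂` the terms u F₂ and u v F₀ in `E₁₂` cancel, leaving F₁₂ = - v F₁, and F₁ = - u F₀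
        -- by `E₁`.
        F₁₂≈vuF₀ : F₁₂ ≈ᵥ v ⊙ (u ⊙ F₀)
        F₁₂≈vuF₀ i = cancel-0 (begin
          (v ⊙ F₁) i + F₁₂ i                     ≈⟨ trans (+-congˡ (⊙-zero-sum u E₂ i)) (+-identityʳ _) ⟨
          (v ⊙ F₁) i + F₁₂ i + ((u ⊙ F₂) i + (u ⊙ (v ⊙ F₀)) i)
            ≈⟨ solve 4 (λ a b c d → a :+ b :+ (c :+ d) := b :+ c :+ a :+ d) refl _ _ _ _ ⟩
          F₁₂ i + (u ⊙ F₂) i + (v ⊙ F₁) i + (u ⊙ (v ⊙ F₀)) i ≈⟨ E₁₂ i ⟩
          0#                                     ∎) (⊙-zero-sum v E₁ i)
          where open ≈-Reasoning

        -- Substitute F₁ = - p F₀ and F₂ = - q F₀ into the ε₁ε₂-coefficient of g″ f″ = 1. Both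
        -- orders of the product appear because r is not yet known to be p q; they are the source of
        -- the factor 2.
        second-order : addV (v ⊙ (u ⊙ F₀)) (r ⊙ F₀) ≈ᵥ addV (p ⊙ (q ⊙ F₀)) (q ⊙ (p ⊙ F₀))
        second-order i = cancel-0 (begin
          (p ⊙ F₂) i + (q ⊙ F₁) i + ((v ⊙ (u ⊙ F₀)) i + (r ⊙ F₀) i) ≈⟨ +-congˡ (+-congʳ (F₁₂≈vuF₀ i)) ⟨
          (p ⊙ F₂) i + (q ⊙ F₁) i + (F₁₂ i + (r ⊙ F₀) i)
            ≈⟨ solve 4 (λ a b c d → a :+ b :+ (c :+ d) := c :+ a :+ b :+ d) refl _ _ _ _ ⟩
          F₁₂ i + (p ⊙ F₂) i + (q ⊙ F₁) i + (r ⊙ F₀) i ≈⟨ F₁₂+pF₂+qF₁+rF₀ i ⟩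
          0#                                           ∎)
          (begin
          (p ⊙ F₂) i + (q ⊙ F₁) i + ((p ⊙ (q ⊙ F₀)) i + (q ⊙ (p ⊙ F₀)) i)
            ≈⟨ solve 4 (λ a b c d → a :+ b :+ (c :+ d) := (a :+ c) :+ (b :+ d)) refl _ _ _ _ ⟩
          (p ⊙ F₂) i + (p ⊙ (q ⊙ F₀)) i + ((q ⊙ F₁) i + (q ⊙ (p ⊙ F₀)) i)
            ≈⟨ +-cong (⊙-zero-sum p F₂+qF₀ i) (⊙-zero-sum q F₁+pF₀ i) ⟩
          0# + 0# ≈⟨ +-identityʳ 0# ⟩
          0# ∎)
          where open ≈-Reasoning

      lifting : Lifting f g u v
      lifting = record
        { p = p ; q = q ; r = r
        ; p-central = central-· f₀-central (λ w i → proj₁ (proj₂ (g-commute w i)))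
        ; q-central = central-· f₀-central (λ w i → proj₁ (proj₂ (proj₂ (g-commute w i))))
        ; r-central = central-· f₀-central (λ w i → proj₂ (proj₂ (proj₂ (g-commute w i))))
        ; u-column = begin
            u ⊙ (f ⊙ eR) ≈⟨ ⊙-congˡ u F₀≈fe ⟨
            -- Both sides are the negative of F₁.
            u ⊙ F₀       ≈⟨ (λ i → cancel-0 (E₁ i) (F₁+pF₀ i)) ⟩
            p ⊙ F₀       ≈⟨ ⊙-congˡ p F₀≈fe ⟩
            p ⊙ (f ⊙ eR) ∎
        ; v-column = begin
            v ⊙ (f ⊙ eR) ≈⟨ ⊙-congˡ v F₀≈fe ⟨
            v ⊙ F₀       ≈⟨ (λ i → cancel-0 (E₂ i) (F₂+qF₀ i)) ⟩
            q ⊙ F₀       ≈⟨ ⊙-congˡ q F₀≈fe ⟩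
            q ⊙ (f ⊙ eR) ∎
        ; u-row = λ w → row-via g₁ w (u ⊙ w) (proj₁ (proj₂ (rows w)))
        ; uv-row = λ w → trans (∙-congˡ e*R (⊙-congˡ g (symᵥ (·-⊙ u v w))))
            (row-via g₁₂ w ((u · v) ⊙ w) (proj₂ (proj₂ (proj₂ (rows w)))))
        ; uv-column = begin
            addV (v ⊙ (u ⊙ (f ⊙ eR))) (r ⊙ (f ⊙ eR))
              ≈⟨ addV-cong (⊙-congˡ v (⊙-congˡ u F₀≈fe)) (⊙-congˡ r F₀≈fe) ⟨
            addV (v ⊙ (u ⊙ F₀)) (r ⊙ F₀)
              ≈⟨ second-order ⟩
            addV (p ⊙ (q ⊙ F₀)) (q ⊙ (p ⊙ F₀))
              ≈⟨ addV-cong (⊙-congˡ p (⊙-congˡ q F₀≈fe)) (⊙-congˡ q (⊙-congˡ p F₀≈fe)) ⟩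
            addV (p ⊙ (q ⊙ (f ⊙ eR))) (q ⊙ (p ⊙ (f ⊙ eR))) ∎
        }
        where open ≈ᵥ-Reasoning

-- The two implications

module Directions {c ℓ} (R : CommutativeRing c ℓ)
  {n} (e e* : Fin n → ℤ) (e*e≡1 : pairℤ e* e ≡ + 1) (τ a y : Lin.Mat (CommutativeRing.rawRing R) n) where

  open CommutativeRing R using (rawRing; isCommutativeRing; _+_; _*_; -_; 0#; 1#)
  open LinearAlgebra rawRing (CommutativeRing._≈_ R) isCommutativeRing
  open MatrixOperations rawRing hiding (module Corner)
  open Tangential R
  open Lin rawRing using (InG; InGcent; _≈ₘ_; IsUnit)
  open Lin.WithE rawRing e e* hiding (1H; τH)
  open MatrixOperations.Corner rawRing eR e*R τ
  open Cyclicity rawRing (CommutativeRing._≈_ R) isCommutativeRing τ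
  open CornerProperties rawRing (CommutativeRing._≈_ R) isCommutativeRing eR e*R τ
  open Rigidity rawRing (CommutativeRing._≈_ R) isCommutativeRing eR e*R τ
    using (Intertwined; column-proportional; row-proportional)
  open Scalarity rawRing (CommutativeRing._≈_ R) isCommutativeRing
  open DualLinearAlgebra R
  open Deformations R e e* τ a y

  e*e≈1 : e*R ∙ eR ≈ 1#
  e*e≈1 = trans (IntegerImage.intR-pairℤ R e* e) (trans (reflexive (≡.cong intR e*e≡1)) (+-identityʳ 1#))

  InHZ⇒tangential : InHZ a → DoublyTangential e e* τ a y
  InHZ⇒tangential (h , r , h∈H , (s , rs≈1) , a≈hr) y″ y″∈H _ = y″∈H
    , baseChange h M″.· y″ , M″.scalarM (incl r)
    , G″.InH-· e e* (baseChange-InH e e* h∈H) (proj₁ y″∈H)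
    , (G″.scalarM-InG (incl s , rs″≈1) , G″.scalarM-central (incl r) (baseChange τ))
    , L″.⊙-injective λ w → begin
        (baseChange a M″.· y″) M″.⊙ w                    ≈⟨ L″.·-⊙ (baseChange a) y″ w ⟩
        baseChange a M″.⊙ (y″ M″.⊙ w)                    ≈⟨ baseChange-a (y″ M″.⊙ w) ⟩
        M″.scaleV (incl r) (baseChange h M″.⊙ (y″ M″.⊙ w))
          ≈⟨ L″.scaleV-cong {r = incl r} L″.refl (L″.·-⊙ (baseChange h) y″ w) ⟨
        M″.scaleV (incl r) ((baseChange h M″.· y″) M″.⊙ w)
          ≈⟨ L″.⊙-scaleV (baseChange h M″.· y″) (incl r) w ⟨
        (baseChange h M″.· y″) M″.⊙ M″.scaleV (incl r) w
          ≈⟨ L″.⊙-congˡ (baseChange h M″.· y″) (L″.scalarM-⊙ (incl r) w) ⟨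
        (baseChange h M″.· y″) M″.⊙ (M″.scalarM (incl r) M″.⊙ w)
          ≈⟨ L″.·-⊙ (baseChange h M″.· y″) (M″.scalarM (incl r)) w ⟨
        ((baseChange h M″.· y″) M″.· M″.scalarM (incl r)) M″.⊙ w ∎
    where
    open L″.≈ᵥ-Reasoning
    x+0y≈x : ∀ {x y} → x + 0# * y ≈ x
    x+0y≈x {x} {y} = trans (+-congˡ (zeroˡ y)) (+-identityʳ x)
    incl-* : ∀ r x₀ x₁ x₂ x₁₂ → RawRing._*_ R'' (incl r) (d2 x₀ x₁ x₂ x₁₂) L″.≈ d2 (r * x₀) (r * x₁) (r * x₂) (r * x₁₂)
    incl-* r x₀ x₁ x₂ x₁₂ = refl , x+0y≈x , x+0y≈x , trans x+0y≈x (trans x+0y≈x x+0y≈x)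
    rs″≈1 : RawRing._*_ R'' (incl r) (incl s) L″.≈ RawRing.1# R''
    rs″≈1 = L″.trans (incl-* r s 0# 0# 0#) (rs≈1 , zeroʳ r , zeroʳ r , zeroʳ r)
    a-⊙ : ∀ w → a ⊙ w ≈ᵥ scaleV r (h ⊙ w)
    a-⊙ w = transᵥ (⊙-congʳ a≈hr w) (transᵥ (·-⊙ h (scalarM r) w)
      (transᵥ (⊙-congˡ h (scalarM-⊙ r w)) (⊙-scaleV h r w)))
    baseChange-a : ∀ w → baseChange a M″.⊙ w L″.≈ᵥ M″.scaleV (incl r) (baseChange h M″.⊙ w)
    baseChange-a w i = L″.trans (baseChange-⊙ a _ _ _ _ i) (L″.trans
      (a-⊙ _ i , a-⊙ _ i , a-⊙ _ i , a-⊙ _ i)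
      (L″.sym (L″.trans (L″.*-congˡ {incl r} (baseChange-⊙ h _ _ _ _ i)) (incl-* r _ _ _ _))))

  module _ (n≥3 : n ≥ 3) (2-unit : IsUnit (1# + 1#)) (stable : IsStable τ) (a∈G : InG a) (y∈X : InX τ a y)
    (tangential : DoublyTangential e e* τ a y) where

    private
      y∈H : InHcent τH y
      y∈H = proj₁ y∈X

      h g f y⁻¹ a⁻¹ : Mat n
      h = proj₁ (proj₂ y∈X)
      g = proj₁ (proj₂ (proj₂ y∈X))
      y⁻¹ = proj₁ (proj₁ (proj₁ y∈H))
      a⁻¹ = proj₁ a∈G

      h∈H : InH h
      h∈H = proj₁ (proj₂ (proj₂ (proj₂ y∈X)))

      g∈Gτ : InGcent τ g
      g∈Gτ = proj₁ (proj₂ (proj₂ (proj₂ (proj₂ y∈X))))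

      ay≈hg : (a · y) ≈ₘ (h · g)
      ay≈hg = proj₂ (proj₂ (proj₂ (proj₂ (proj₂ y∈X))))

      f = proj₁ (proj₁ g∈Gτ)

      gf≈1 : (g · f) ≈ₘ idM
      gf≈1 = proj₁ (proj₂ (proj₁ g∈Gτ))

      fg≈1 : (f · g) ≈ₘ idM
      fg≈1 = proj₂ (proj₂ (proj₁ g∈Gτ))

      f-central : Central f
      f-central = G.inverse-commute gf≈1 fg≈1 (proj₂ g∈Gτ)

      g-central : Central g
      g-central = G.·-commute (proj₂ g∈Gτ)

      fg : ∀ w → f ⊙ (g ⊙ w) ≈ᵥ w
      fg = G.inverse-⊙ fg≈1

      gf : ∀ w → g ⊙ (f ⊙ w) ≈ᵥ w
      gf = G.inverse-⊙ gf≈1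

      c-gen : Generates (f ⊙ eR)
      c-gen = generates-image f-central fg (proj₁ stable)

      lift : ∀ j k → Lifting f g (τH^ j) (τH^ k)
      lift j k = lifting a∈G y∈H tangential h∈H ay≈hg gf≈1
        (τH^-comm e*e≈1 j k) (τH^-e e*e≈1 j) (τH^-e e*e≈1 k)
        (e*-τH^ e*e≈1 j) (e*-τH^ e*e≈1 k) (τH^-τH e*e≈1 j) (τH^-τH e*e≈1 k)

      -- The second direction is an arbitrary choice. A lift may depend on both directions; `p-+`
      -- reconciles the choices by comparing their values on the cyclic vector c.
      p : ℕ → Mat n
      p k = Lifting.p (lift k k)

      p-central : ∀ k → Central (p k)
      p-central k = Lifting.p-central (lift k k)

      τH^-column : ∀ k → τH^ k ⊙ (f ⊙ eR) ≈ᵥ p k ⊙ (f ⊙ eR)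
      τH^-column k = Lifting.u-column (lift k k)

      τH^-row : ∀ k w → e*R ∙ (g ⊙ (τH^ k ⊙ w)) ≈ e*R ∙ (g ⊙ (p k ⊙ w))
      τH^-row k = Lifting.u-row (lift k k)

      -- The covector b = e* g is cyclic along with e*: inserting g f = 1 rewrites e* q(τ) x w as b
      -- x f q(τ) w for each polynomial q, so the row b x determines x.
      row-injective : ∀ {x x′} → Central x → Central x′ →
        (∀ w → e*R ∙ (g ⊙ (x ⊙ w)) ≈ e*R ∙ (g ⊙ (x′ ⊙ w))) → ∀ w → x ⊙ w ≈ᵥ x′ ⊙ w
      row-injective {x} {x′} x-central x′-central eq w = nondegenerate (proj₂ stable) λ cs →
        trans (move x-central cs) (trans (eq _) (sym (move x′-central cs)))
        where
        move : ∀ {x} → Central x → ∀ cs →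
          e*R ∙ polyApp cs τ (x ⊙ w) ≈ e*R ∙ (g ⊙ (x ⊙ (f ⊙ polyApp cs τ w)))
        move {x} x-central cs = ∙-congˡ e*R (begin
          polyApp cs τ (x ⊙ w)             ≈⟨ polyApp-central x-central cs w ⟨
          x ⊙ polyApp cs τ w               ≈⟨ ⊙-congˡ x (gf _) ⟨
          x ⊙ (g ⊙ (f ⊙ polyApp cs τ w))   ≈⟨ central-comm (proj₁ stable) x-central g-central _ ⟩
          g ⊙ (x ⊙ (f ⊙ polyApp cs τ w))   ∎)
          where open ≈ᵥ-Reasoning

      halve : ∀ {x y} → x + x ≈ y + y → x ≈ y
      halve {x} {y} eq = begin
        x                      ≈⟨ half x ⟨
        proj₁ 2-unit * (x + x) ≈⟨ *-congˡ eq ⟩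
        proj₁ 2-unit * (y + y) ≈⟨ half y ⟩
        y                      ∎
        where
        open ≈-Reasoning
        half : ∀ x → proj₁ 2-unit * (x + x) ≈ x
        half x = begin
          proj₁ 2-unit * (x + x)           ≈⟨ *-congˡ (+-cong (*-identityˡ x) (*-identityˡ x)) ⟨
          proj₁ 2-unit * (1# * x + 1# * x) ≈⟨ *-congˡ (distribʳ x 1# 1#) ⟨
          proj₁ 2-unit * ((1# + 1#) * x)   ≈⟨ *-assoc _ _ _ ⟨
          proj₁ 2-unit * (1# + 1#) * x     ≈⟨ *-congʳ (trans (*-comm _ _) (proj₂ 2-unit)) ⟩
          1# * x                           ≈⟨ *-identityˡ x ⟩
          x                                ∎

      -- In `uv-column` the term coming from the product of directions is `p (j + k)` c by the
      -- column relation, and r is `p (j + k)` by `row-injective`. The left side is thus twice one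
      -- vector, the right side twice the product, and 2 is cancelled.
      p-+ : ∀ j k → p j ⊙ (p k ⊙ (f ⊙ eR)) ≈ᵥ p (j ℕ.+ k) ⊙ (f ⊙ eR)
      p-+ j k i = halve (begin
        (p j ⊙ (p k ⊙ c₀)) i + (p j ⊙ (p k ⊙ c₀)) i
          ≈⟨ +-congˡ (central-comm (proj₁ stable) (p-central j) (p-central k) c₀ i) ⟩
        (p j ⊙ (p k ⊙ c₀)) i + (p k ⊙ (p j ⊙ c₀)) i
          ≈⟨ +-cong same-j same-k ⟩
        (P ⊙ (Q ⊙ c₀)) i + (Q ⊙ (P ⊙ c₀)) i
          ≈⟨ Lifting.uv-column L i ⟨
        (τH^ k ⊙ (τH^ j ⊙ c₀)) i + (Lifting.r L ⊙ c₀) i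
          ≈⟨ +-cong (trans (τH^-comm e*e≈1 k j c₀ i) (trans (τH^-+ e*e≈1 j k c₀ i) (τH^-column (j ℕ.+ k) i)))
               (row-injective (Lifting.r-central L) (p-central (j ℕ.+ k)) r-row c₀ i) ⟩
        (p (j ℕ.+ k) ⊙ c₀) i + (p (j ℕ.+ k) ⊙ c₀) i ∎)
        where
        open ≈-Reasoning
        c₀ : Vect n
        c₀ = f ⊙ eR
        L = lift j k
        P Q : Mat n
        P = Lifting.p L
        Q = Lifting.q L
        p≈P : p j ⊙ c₀ ≈ᵥ P ⊙ c₀
        p≈P = transᵥ (symᵥ (τH^-column j)) (Lifting.u-column L)
        p≈Q : p k ⊙ c₀ ≈ᵥ Q ⊙ c₀
        p≈Q = transᵥ (symᵥ (τH^-column k)) (Lifting.v-column L)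
        same-j : (p j ⊙ (p k ⊙ c₀)) i ≈ (P ⊙ (Q ⊙ c₀)) i
        same-j = trans (⊙-congˡ (p j) p≈Q i) (central-ext (p-central j) (Lifting.p-central L) c-gen p≈P _ i)
        same-k : (p k ⊙ (p j ⊙ c₀)) i ≈ (Q ⊙ (P ⊙ c₀)) i
        same-k = trans (⊙-congˡ (p k) p≈P i) (central-ext (p-central k) (Lifting.q-central L) c-gen p≈Q _ i)
        r-row : ∀ w → e*R ∙ (g ⊙ (Lifting.r L ⊙ w)) ≈ e*R ∙ (g ⊙ (p (j ℕ.+ k) ⊙ w))
        r-row w = begin
          e*R ∙ (g ⊙ (Lifting.r L ⊙ w))        ≈⟨ Lifting.uv-row L w ⟨
          e*R ∙ (g ⊙ (τH^ j ⊙ (τH^ k ⊙ w)))    ≈⟨ ∙-congˡ e*R (⊙-congˡ g (τH^-+ e*e≈1 j k w)) ⟩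
          e*R ∙ (g ⊙ (τH^ (j ℕ.+ k) ⊙ w))      ≈⟨ τH^-row (j ℕ.+ k) w ⟩
          e*R ∙ (g ⊙ (p (j ℕ.+ k) ⊙ w))        ∎

      intertwined : Intertwined f g p
      intertwined = record
        { e*e≈1 = e*e≈1 ; e-gen = proj₁ stable ; e*-gen = proj₂ stable
        ; f-central = f-central ; g-central = g-central ; p-central = p-central
        ; fg = fg ; gf = gf
        ; τH^-column = τH^-column ; τH^-row = τH^-row ; p-+ = p-+ }

      ν λ₀ r₀ : RawRing.Carrier rawRing
      λ₀ = e*R ∙ (f ⊙ eR)
      r₀ = e*R ∙ (g ⊙ eR)
      ν  = proj₁ (λ-invertible n≥3 eR e*R τ intertwined)

      νλ≈1 : ν * λ₀ ≈ 1#
      νλ≈1 = proj₂ (λ-invertible n≥3 eR e*R τ intertwined)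

      fe≈λe : f ⊙ eR ≈ᵥ scaleV λ₀ eR
      fe≈λe = column-proportional intertwined {ν} νλ≈1

      e*g-proportional : ∀ w → e*R ∙ (g ⊙ w) ≈ e*R ∙ w * r₀
      e*g-proportional = row-proportional intertwined {ν} νλ≈1

      -- Evaluate b = r₀ e* on c, where b c = e* g f e = e* e. The row and column scalars are
      -- therefore mutually inverse, which is why one multiple of a can fix both e and e*.
      λr≈1 : λ₀ * r₀ ≈ 1#
      λr≈1 = begin
        λ₀ * r₀                ≈⟨ e*g-proportional (f ⊙ eR) ⟨
        e*R ∙ (g ⊙ (f ⊙ eR))   ≈⟨ ∙-congˡ e*R (gf eR) ⟩
        e*R ∙ eR               ≈⟨ e*e≈1 ⟩
        1#                     ∎
        where open ≈-Reasoning

      aλe : a ⊙ scaleV λ₀ eR ≈ᵥ eR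
      aλe = begin
        a ⊙ scaleV λ₀ eR         ≈⟨ ⊙-congˡ a (scaleV-cong refl (proj₁ (proj₂ (proj₁ y∈H)))) ⟨
        a ⊙ scaleV λ₀ (y ⊙ eR)   ≈⟨ ⊙-congˡ a (⊙-scaleV y λ₀ eR) ⟨
        a ⊙ (y ⊙ scaleV λ₀ eR)   ≈⟨ ⊙-congˡ a (⊙-congˡ y fe≈λe) ⟨
        a ⊙ (y ⊙ (f ⊙ eR))       ≈⟨ ·-⊙ a y (f ⊙ eR) ⟨
        (a · y) ⊙ (f ⊙ eR)       ≈⟨ G.factor-column e e* h∈H ay≈hg gf≈1 ⟩
        eR                       ∎
        where open ≈ᵥ-Reasoning

      e*a : ∀ w → e*R ∙ (a ⊙ w) ≈ e*R ∙ w * r₀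
      e*a w = begin
        e*R ∙ (a ⊙ w)               ≈⟨ ∙-congˡ e*R (⊙-congˡ a (yy⁻¹ w)) ⟨
        e*R ∙ (a ⊙ (y ⊙ (y⁻¹ ⊙ w))) ≈⟨ ∙-congˡ e*R (·-⊙ a y (y⁻¹ ⊙ w)) ⟨
        e*R ∙ ((a · y) ⊙ (y⁻¹ ⊙ w)) ≈⟨ G.factor-row e e* h∈H ay≈hg (y⁻¹ ⊙ w) ⟩
        e*R ∙ (g ⊙ (y⁻¹ ⊙ w))       ≈⟨ e*g-proportional (y⁻¹ ⊙ w) ⟩
        e*R ∙ (y⁻¹ ⊙ w) * r₀        ≈⟨ *-congʳ (G.row-⊙ e e* (proj₂ (proj₂ (proj₁ y∈H))) (y⁻¹ ⊙ w)) ⟨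
        e*R ∙ (y ⊙ (y⁻¹ ⊙ w)) * r₀  ≈⟨ *-congʳ (∙-congˡ e*R (yy⁻¹ w)) ⟩
        e*R ∙ w * r₀                ∎
        where
        open ≈-Reasoning
        yy⁻¹ : ∀ w → y ⊙ (y⁻¹ ⊙ w) ≈ᵥ w
        yy⁻¹ = G.inverse-⊙ (proj₁ (proj₂ (proj₁ (proj₁ y∈H))))

      aλ : Mat n
      aλ = a · scalarM λ₀

      aλ-⊙ : ∀ w → aλ ⊙ w ≈ᵥ a ⊙ scaleV λ₀ w
      aλ-⊙ w = transᵥ (·-⊙ a (scalarM λ₀) w) (⊙-congˡ a (scalarM-⊙ λ₀ w))

      λν≈1 : λ₀ * ν ≈ 1#
      λν≈1 = trans (*-comm λ₀ ν) νλ≈1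

    tangential⇒InHZ : InHZ a
    -- The multiple λ a lies in H, so the scalar that recovers a is the inverse ν of λ.
    tangential⇒InHZ = aλ , ν
      , ( G.InG-· a∈G (G.scalarM-InG (ν , λν≈1))
        , transᵥ (aλ-⊙ eR) aλe
        , G.⊙-row e e* (λ w → begin
            e*R ∙ (aλ ⊙ w)          ≈⟨ ∙-congˡ e*R (aλ-⊙ w) ⟩
            e*R ∙ (a ⊙ scaleV λ₀ w) ≈⟨ e*a (scaleV λ₀ w) ⟩
            e*R ∙ scaleV λ₀ w * r₀  ≈⟨ *-congʳ (trans (∙-scaleV e*R λ₀ w) (*-comm λ₀ _)) ⟩
            e*R ∙ w * λ₀ * r₀       ≈⟨ *-assoc _ λ₀ r₀ ⟩
            e*R ∙ w * (λ₀ * r₀)     ≈⟨ *-congˡ λr≈1 ⟩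
            e*R ∙ w * 1#            ≈⟨ *-identityʳ _ ⟩
            e*R ∙ w                 ∎) )
      , (λ₀ , νλ≈1)
      , ⊙-injective (λ w → symᵥ (transᵥ (·-⊙ aλ (scalarM ν) w) (transᵥ (⊙-congˡ aλ (scalarM-⊙ ν w))
          (transᵥ (aλ-⊙ (scaleV ν w)) (⊙-congˡ a (λ i →
            trans (sym (*-assoc λ₀ ν (w i))) (trans (*-congʳ λν≈1) (*-identityˡ (w i)))))))))
      where open ≈-Reasoning

theorem5p6 : ∀ {c ℓ : Level} (R : CommutativeRing c ℓ) →
    let open Tangential R in
    ∀ (n : ℕ) → n ≥ 3 →
    ∀ (e e* : Fin n → ℤ) → pairℤ e* e ≡ + 1 →
    L.IsUnit L.two →
    ∀ (τ a y : L.Mat n) →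
    L.WithE.IsStable e e* τ →
    L.InG a →
    L.WithE.InX e e* τ a y →
    (DoublyTangential e e* τ a y ⇔ L.WithE.InHZ e e* a)
theorem5p6 R n n≥3 e e* e*e≡1 2-unit τ a y stable a∈G y∈X =
  mk⇔ (tangential⇒InHZ n≥3 2-unit stable a∈G y∈X) InHZ⇒tangential
  where open Directions R e e* e*e≡1 τ a y
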